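{- Let $G$ be a finite simple graph with adjacency matrix $A$ and a Godsil-McKay switching set $X$, let $Y=V(G)\setminus X$, and let $G'$ be the graph obtained from $G$ by Godsil-McKay switching with respect to $X$. Order the vertices so that \[ A=\begin{bmatrix} B & M\\ M^{\top} & C\end{bmatrix},\qquad M=\begin{bmatrix} N & J & O\end{bmatrix}, \] where $B$ is the adjacency matrix of the subgraph induced on $X$, and the columns of $N$, $J$, $O$ correspond to the vertices of $Y$ having exactly $\tfrac12|X|$, exactly $|X|$, and no neighbours in $X$, respectively. Suppose that all vertices of $X$ have the same degree in $G$, and that $\overline{\Lambda}_G=\overline{\Lambda}_{G'}$. Suppose furthermore that either (a) $B=O$ (i.e. $X$ is a coclique), $N$ has at least two columns, and no two rows of $N$ are complementary; or (b) $B$ has all row sums equal to $\tfrac12|X|$, and no two rows of the matrix $[\,B\ \ N\,]$ are complementary. Let $H$ be a finite simple graph and $i$ a vertex of $H$. Then $\{i\}\times X$ is a Godsil-McKay switching set both in $H\times G$ and in $H\boxtimes G$. Moreover, if $i$ has degree at least one in $H$, then Godsil-McKay switching in $H\boxtimes G$ with respect to $\{i\}\times X$ yields a graph that is cospectral with but not isomorphic to $H\boxtimes G$; and if $i$ is adjacent in $H$ to a vertex of degree at least two, then Godsil-McKay switching in $H\times G$ with respect to $\{i\}\times X$ yields a graph that is cospectral with but not isomorphic to $H\times G$.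
   Context: A subset $X$ of the vertex set of a graph $G$ is a (Godsil-McKay) switching set if $X$ induces a regular subgraph of $G$ and every vertex outside $X$ has either $0$, $\tfrac12|X|$ or $|X|$ neighbours in $X$. Godsil-McKay switching with respect to $X$ produces the graph $G'$ on the same vertex set obtained as follows: for each vertex $x\notin X$ having exactly $\tfrac12|X|$ neighbours in $X$, delete the edges from $x$ to these neighbours and join $x$ instead to the other $\tfrac12|X|$ vertices of $X$; all other adjacencies are unchanged. For a graph $\Gamma$ and vertices $x,y$, $\lambda_\Gamma(x,y)$ is the number of common neighbours of $x$ and $y$; $\overline{\Lambda}_G$ denotes the multiset $\{\lambda_G(x,y)\mid x\in X,\ y\in Y\}$ and $\overline{\Lambda}_{G'}=\{\lambda_{G'}(x,y)\mid x\in X,\ y\in Y\}$. Two rows of a $(0,1)$-matrix are complementary if their sum is the all-ones row. Two graphs are cospectral if their adjacency matrices have the same spectrum. If $H$ has adjacency matrix $E$, the tensor product $H\times G$ is the graph on $V(H)\times V(G)$ with adjacency matrix $E\otimes A$ (i.e. $(j,x)\sim(k,y)$ iff $j\sim k$ in $H$ and $x\sim y$ in $G$), and the strengthened tensor product $H\boxtimes G$ is the graph on $V(H)\times V(G)$ with adjacency matrix $(E+I)\otimes A$ (i.e. $(j,x)\sim(k,y)$ iff ($j=k$ or $j\sim k$ in $H$) and $x\sim y$ in $G$). -}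

module Defs where

open import Algebra.Apartness.Bundles using (HeytingField; HeytingCommutativeRing)
open import Algebra.Bundles using (CommutativeRing)
import Algebra.Definitions.RawMonoid as RawMonoidDefs
open import Data.Bool.Base using (Bool; true; false; not; _∧_; _∨_; if_then_else_)
open import Data.Bool.Properties using (∨-comm; ∧-zeroʳ)
open import Data.Fin.Base using (Fin; zero; suc; quotient; remainder)
open import Data.Fin.Permutation using (Permutation; _⟨$⟩ʳ_)
import Data.Fin.Properties as Fin
open import Data.Fin.Subset using (Subset; _∈_; _∉_; _∩_; ∁; ∣_∣)
open import Data.Fin.Subset.Properties using (_∈?_)
open import Data.List.Base using (List; allFin; filter; cartesianProductWith)
open import Data.Nat.Base using (ℕ; suc; _+_; _*_)
import Data.Nat.Properties as ℕ
open import Data.Product.Base using (Σ-syntax; ∃-syntax; _×_)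
open import Data.Sum.Base using (_⊎_)
open import Data.Vec.Base using (_∷_; lookup; tabulate)
open import Data.Vec.Functional using (Vector)
open import Function.Bundles using (_⇔_)
open import Level using (_⊔_) renaming (suc to lsuc)
open import Relation.Binary.PropositionalEquality using (_≡_; _≢_; refl; sym; trans; cong; cong₂)
open import Relation.Nullary.Decidable using (yes; no; ⌊_⌋)
open import Relation.Nullary.Negation using (¬_; contradiction)

private
  variable
    m n : ℕ

------------------------------------------------------------------------
-- Finite simple graphs

record Graph (n : ℕ) : Set where
  field
    adj        : Fin n → Fin n → Bool
    adj-sym    : ∀ u v → adj u v ≡ adj v u
    adj-irrefl : ∀ u → adj u u ≡ false

open Graph public

nbhd : Graph n → Fin n → Subset n
nbhd G u = tabulate (adj G u)

degree : Graph n → Fin n → ℕ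
degree G u = ∣ nbhd G u ∣

nbrsIn : Graph n → Subset n → Fin n → ℕ
nbrsIn G X v = ∣ X ∩ nbhd G v ∣

commonNbrs : Graph n → Fin n → Fin n → ℕ
commonNbrs G u v = ∣ nbhd G u ∩ nbhd G v ∣

infix 4 _≅_

_≅_ : Graph m → Graph n → Set
_≅_ {m} {n} G G′ =
  Σ[ π ∈ Permutation m n ] (∀ u v → adj G u v ≡ adj G′ (π ⟨$⟩ʳ u) (π ⟨$⟩ʳ v))

------------------------------------------------------------------------
-- Godsil-McKay switching

record IsSwitchingSet (G : Graph n) (X : Subset n) : Set where
  field
    regular : ∃[ k ] (∀ u → u ∈ X → nbrsIn G X u ≡ k)
    outside : ∀ v → v ∉ X →
              nbrsIn G X v ≡ 0 ⊎ 2 * nbrsIn G X v ≡ ∣ X ∣ ⊎ nbrsIn G X v ≡ ∣ X ∣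

-- The vertices outside X with exactly ½|X| neighbours in X: the columns of N.
halfSet : Graph n → Subset n → Subset n
halfSet G X = ∁ X ∩ tabulate (λ v → ⌊ 2 * nbrsIn G X v ℕ.≟ ∣ X ∣ ⌋)

toggled : Graph n → Subset n → Fin n → Fin n → Bool
toggled G X u v = (lookup X u ∧ lookup (halfSet G X) v)
                ∨ (lookup X v ∧ lookup (halfSet G X) u)

private
  ∁-disjoint : (p q : Subset n) → ∀ u → lookup p u ∧ lookup (∁ p ∩ q) u ≡ false
  ∁-disjoint (true  ∷ _) (_ ∷ _) zero    = refl
  ∁-disjoint (false ∷ _) (_ ∷ _) zero    = refl
  ∁-disjoint (_ ∷ p)     (_ ∷ q) (suc u) = ∁-disjoint p q u

  toggled-sym : (G : Graph n) (X : Subset n) → ∀ u v → toggled G X u v ≡ toggled G X v u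
  toggled-sym G X u v = ∨-comm (lookup X u ∧ lookup (halfSet G X) v) _

  toggled-irrefl : (G : Graph n) (X : Subset n) → ∀ u → toggled G X u u ≡ false
  toggled-irrefl G X u = cong₂ _∨_ (∁-disjoint X _ u) (∁-disjoint X _ u)

switch : Graph n → Subset n → Graph n
switch G X = record
  { adj        = λ u v → if toggled G X u v then not (adj G u v) else adj G u v
  ; adj-sym    = λ u v → cong₂ (λ t a → if t then not a else a)
                           (toggled-sym G X u v) (adj-sym G u v)
  ; adj-irrefl = λ u → cong₂ (λ t a → if t then not a else a)
                         (toggled-irrefl G X u) (adj-irrefl G u)
  }

elements : Subset n → List (Fin n)
elements {n} X = filter (_∈? X) (allFin n)

-- Multisets are lists up to permutation (_↭_).
Λ̄ : Graph n → Subset n → List ℕ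
Λ̄ G X = cartesianProductWith (commonNbrs G) (elements X) (elements (∁ X))

entry : Graph n → Fin n → Fin n → ℕ
entry G u v = if adj G u v then 1 else 0

-- The rows u and v of the adjacency matrix, restricted to the columns in S,
-- sum to the all-ones row.
ComplementaryOn : Graph n → Subset n → Fin n → Fin n → Set
ComplementaryOn G S u v = ∀ w → w ∈ S → entry G u w + entry G v w ≡ 1

NoComplementaryRows : Graph n → (X S : Subset n) → Set
NoComplementaryRows G X S =
  ∀ u v → u ∈ X → v ∈ X → u ≢ v → ¬ ComplementaryOn G S u v

------------------------------------------------------------------------
-- Products

-- V(H) × V(G) is identified with Fin (m * n) through the bijection whose two
-- components are quotient and remainder, the usual ordering for E ⊗ A.

infixr 7 _×ᵍ_ _⊠_ _×ˢ_

_×ᵍ_ : Graph m → Graph n → Graph (m * n)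
_×ᵍ_ {m} {n} H G = record
  { adj        = λ p q → adj H (π₁ p) (π₁ q) ∧ adj G (π₂ p) (π₂ q)
  ; adj-sym    = λ p q → cong₂ _∧_ (adj-sym H (π₁ p) (π₁ q)) (adj-sym G (π₂ p) (π₂ q))
  ; adj-irrefl = λ p → trans (cong (adj H (π₁ p) (π₁ p) ∧_) (adj-irrefl G (π₂ p)))
                         (∧-zeroʳ (adj H (π₁ p) (π₁ p)))
  }
  where
  π₁ = quotient {m} n
  π₂ = remainder {m} n

adjOrEq : Graph m → Fin m → Fin m → Bool
adjOrEq H j k = ⌊ j Fin.≟ k ⌋ ∨ adj H j k

private
  ≟-sym : (j k : Fin m) → ⌊ j Fin.≟ k ⌋ ≡ ⌊ k Fin.≟ j ⌋
  ≟-sym j k with j Fin.≟ k | k Fin.≟ j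
  ... | yes _   | yes _   = refl
  ... | no  _   | no  _   = refl
  ... | yes j≡k | no  k≢j = contradiction (sym j≡k) k≢j
  ... | no  j≢k | yes k≡j = contradiction (sym k≡j) j≢k

_⊠_ : Graph m → Graph n → Graph (m * n)
_⊠_ {m} {n} H G = record
  { adj        = λ p q → adjOrEq H (π₁ p) (π₁ q) ∧ adj G (π₂ p) (π₂ q)
  ; adj-sym    = λ p q → cong₂ _∧_
                   (cong₂ _∨_ (≟-sym (π₁ p) (π₁ q)) (adj-sym H (π₁ p) (π₁ q)))
                   (adj-sym G (π₂ p) (π₂ q))
  ; adj-irrefl = λ p → trans (cong (adjOrEq H (π₁ p) (π₁ p) ∧_) (adj-irrefl G (π₂ p)))
                         (∧-zeroʳ (adjOrEq H (π₁ p) (π₁ p)))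
  }
  where
  π₁ = quotient {m} n
  π₂ = remainder {m} n

_×ˢ_ : Subset m → Subset n → Subset (m * n)
_×ˢ_ {m} {n} P Q =
  tabulate (λ p → lookup P (quotient {m} n p) ∧ lookup Q (remainder {m} n p))

------------------------------------------------------------------------
-- Spectra

module Spectrum {c ℓ₁ ℓ₂} (F : HeytingField c ℓ₁ ℓ₂) where
  open HeytingField F using (Carrier; _≈_; _#_; 0#; 1#; heytingCommutativeRing)
    renaming (_*_ to _·_)
  open HeytingCommutativeRing heytingCommutativeRing using (commutativeRing)
  open CommutativeRing commutativeRing using (+-rawMonoid)
  open RawMonoidDefs +-rawMonoid using (sum) renaming (_×_ to _⋆_)

  CharZero : Set ℓ₂
  CharZero = ∀ k → (suc k ⋆ 1#) # 0#

  adjMatrix : Graph n → Fin n → Fin n → Carrier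
  adjMatrix G u v = if adj G u v then 1# else 0#

  InEigenspace : Graph n → Carrier → Vector Carrier n → Set ℓ₁
  InEigenspace G θ x = ∀ u → sum (λ v → adjMatrix G u v · x v) ≈ θ · x u

  combination : Vector Carrier m → Vector (Vector Carrier n) m → Vector Carrier n
  combination a b u = sum (λ k → a k · b k u)

  -- The eigenspace of θ has a basis of k vectors.  Adjacency matrices are
  -- symmetric with real eigenvalues, hence diagonalizable, so this k is the
  -- multiplicity of θ in the spectrum; k = 0 means that θ is not an eigenvalue.
  record HasMultiplicity (G : Graph n) (θ : Carrier) (k : ℕ) : Set (c ⊔ ℓ₁) where
    field
      basis       : Vector (Vector Carrier n) k
      eigen       : ∀ j → InEigenspace G θ (basis j)
      independent : ∀ a → (∀ u → combination a basis u ≈ 0#) → ∀ j → a j ≈ 0#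
      spanning    : ∀ x → InEigenspace G θ x →
                    ∃[ a ] (∀ u → x u ≈ combination a basis u)

-- The library has no real numbers, so the field in which eigenvalues are taken
-- ranges over all Heyting fields of characteristic zero (at the given levels);
-- models of ℝ are instances.
Cospectral : ∀ c ℓ₁ ℓ₂ → Graph m → Graph n → Set (lsuc (c ⊔ ℓ₁ ⊔ ℓ₂))
Cospectral c ℓ₁ ℓ₂ G G′ =
  (F : HeytingField c ℓ₁ ℓ₂) → let open Spectrum F in CharZero →
  ∀ θ k → HasMultiplicity G θ k ⇔ HasMultiplicity G′ θ k

{-# OPTIONS --safe #-}

-- Write A for the adjacency matrix of a graph with switching set Z.  Switching replaces
-- A by Q A Q with Q = diag(2J/|Z| − I, I), an involution, so Q maps eigenspaces to
-- eigenspaces; and it replaces A² by Q A² Q, so the numbers of common neighbours can only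
-- change between Z and its complement, provided the vertices of Z have equal degrees.
-- For Z = {i} × X these numbers are e λ(x , z) with e = (E²)ᵢₖ (or ((E + I)²)ᵢₖ).  Over
-- z ∉ X they form the same multiset before and after, because Λ̄ does not change.  For
-- z ∈ X and k ≠ i, let d be the common degree on X: e λ(x , z) becomes e times the number
-- of common neighbours after complementing the half columns of row x, which is less than
-- d as no two rows are complementary.  So the value e d with e maximal, attained at z = x,
-- disappears.

module Submission where

open import Defs
open import Algebra.Apartness.Bundles using (HeytingField; HeytingCommutativeRing)
open import Algebra.Bundles using (CommutativeRing)
import Algebra.Properties.CommutativeSemigroup as CommutativeSemigroupProperties
open import Data.Bool.Base using (Bool; true; false; if_then_else_; _∧_; _∨_; not)
open import Data.Bool.Properties using (∨-zeroʳ)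
open import Data.Fin.Base using (Fin; zero; suc; combine; quotient; remainder; _↑ˡ_; _↑ʳ_)
open import Data.Fin.Permutation using (_⟨$⟩ʳ_)
import Data.Fin.Properties as Fin
open import Data.Fin.Subset using (Subset; _∈_; _∉_; _∩_; _∪_; ∁; ∣_∣; ⊤; ⁅_⁆; Nonempty)
open import Data.Fin.Subset.Properties
  using (_∈?_; ∈⊤; x∈⁅x⁆; x∈⁅y⁆⇒x≡y; ∣⁅x⁆∣≡1; x∈∁p⇒x∉p; x∉p⇒x∈∁p; x∈p∪q⁺; x∈p∪q⁻)
open import Data.List.Base using (List; []; _∷_; _++_; map; filter; allFin; cartesianProductWith)
  renaming (tabulate to tabulateˡ)
open import Data.List.Extrema.Nat using (argmax; argmax-all; f[xs]≤f[argmax])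
open import Data.List.Membership.Propositional.Properties using (∈-filter⁺; ∈-allFin)
open import Data.List.Properties using (map-++; map-∘)
open import Data.List.Relation.Binary.Permutation.Propositional using (_↭_)
import Data.List.Relation.Binary.Permutation.Propositional.Properties as ↭
import Data.List.Relation.Unary.All as All
open import Data.List.Relation.Unary.All.Properties using (all-filter)
open import Data.Nat.Base using (ℕ; zero; suc; _*_; _≤_; _<_; z≤n; s≤s; NonZero; >-nonZero)
open import Data.Nat.ListAction using () renaming (sum to sumˡ)
open import Data.Nat.ListAction.Properties using (sum-++; sum-↭)
open import Data.Product.Base using (_×_; _,_; proj₁; proj₂; ∃-syntax)
open import Data.Sum.Base as Sum using (_⊎_; inj₁; inj₂)
open import Data.Vec.Base using ([]; _∷_; lookup)
open import Data.Vec.Functional using (Vector)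
open import Data.Vec.Properties
  using (lookup∘tabulate; lookup-zipWith; lookup-map; lookup-replicate; []=⇒lookup; lookup⇒[]=)
open import Function.Base using (_∘_; id)
open import Function.Bundles using (_⇔_; mk⇔)
open import Level using (Level)
open import Relation.Binary.PropositionalEquality using (_≡_)
open import Relation.Nullary.Decidable using (does; yes; no; ⌊_⌋; _×-dec_)
open import Relation.Nullary.Negation using (¬_; contradiction)

private
  variable
    m n : ℕ

-- Switching reflects the part of a column indexed by the switching set Z in its mean: a′ = 2 s /
-- |Z| - a, with s the sum of that part. The counting half of the proof keeps this relation in the
-- form |Z| (a′ + a) ≡ 2 s over ℕ, so neither division nor subtraction occurs there. The common
-- neighbour counts between Z and its complement obey the same relation with their own mean. For z
-- in X the mean of λ(· , z) over X is (d + J) / 2, where J counts the vertices adjacent to all of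
-- X. So e λ(x , z) turns into e (d + J - λ(x , z)), and the strictness to be proved is J < λ(x ,
-- z). The obstacle is that a switching set of G constrains the columns outside X only, whereas (k ,
-- v) with v in X lies outside Z as soon as k ≠ i. This gap is what (a) and (b) close: a vertex of X
-- has no neighbours in X, or exactly half of X, so every column of A behaves over X like a column
-- of M. Multisets are compared by summing the indicator of a single value over all ordered pairs of
-- vertices, a number that an isomorphism preserves.

module CommonNeighbours where

  open import Data.Nat.Base using (_+_)
  open import Data.Nat.Properties
  open CommutativeSemigroupProperties *-commutativeSemigroup using () renaming (x∙yz≈y∙xz to x*yz≈y*xz)
  open import Data.Nat.Tactic.RingSolver using (solve-∀)
  open import Relation.Binary.PropositionalEquality
    using (refl; sym; trans; cong; cong₂; subst; subst₂; _≢_; ≢-sym; module ≡-Reasoning)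
  open import Algebra.Properties.Semiring.Sum +-*-semiring
    using (sum; sum-cong-≗; ∑-distrib-+; ∑-comm; *-distribˡ-sum; *-distribʳ-sum; sum-permute)

  -- Sums over subsets

  ⟦_⟧ : Bool → ℕ
  ⟦ b ⟧ = if b then 1 else 0

  ⟦⟧-∧ : ∀ b c → ⟦ b ∧ c ⟧ ≡ ⟦ b ⟧ * ⟦ c ⟧
  ⟦⟧-∧ true  c = sym (+-identityʳ ⟦ c ⟧)
  ⟦⟧-∧ false c = refl

  -- Weighted by the indicator over all of `Fin n`, so that distributivity and interchange come from
  -- the library's lemmas on `sum`.
  ∑∈ : Subset n → (Fin n → ℕ) → ℕ
  ∑∈ X f = sum (λ u → ⟦ lookup X u ⟧ * f u)

  syntax ∑∈ X (λ u → e) = ∑[ u ∈ X ] e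
  infixl 10 ∑∈

  ∑∈-cong : (X : Subset n) {f g : Fin n → ℕ} → (∀ u → u ∈ X → f u ≡ g u) → ∑∈ X f ≡ ∑∈ X g
  ∑∈-cong X {f} {g} f≡g = sum-cong-≗ (λ u → term u (lookup X u) refl)
    where
    term : ∀ u b → lookup X u ≡ b → ⟦ b ⟧ * f u ≡ ⟦ b ⟧ * g u
    term u true  u∈X = cong (_+ 0) (f≡g u (lookup⇒[]= u X u∈X))
    term u false _   = refl

  ∑∈-+ : (X : Subset n) (f g : Fin n → ℕ) → ∑[ u ∈ X ] (f u + g u) ≡ ∑∈ X f + ∑∈ X g
  ∑∈-+ {n} X f g = trans (sum-cong-≗ (λ u → *-distribˡ-+ ⟦ lookup X u ⟧ (f u) (g u))) (∑-distrib-+ {n} _ _)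

  ∑∈-* : (X : Subset n) (c : ℕ) (f : Fin n → ℕ) → ∑[ u ∈ X ] (c * f u) ≡ c * ∑∈ X f
  ∑∈-* {n} X c f = trans (sum-cong-≗ (λ u → x*yz≈y*xz ⟦ lookup X u ⟧ c (f u))) (sym (*-distribˡ-sum {n} c _))

  ∑∈-comm : (X : Subset m) (Y : Subset n) (f : Fin m → Fin n → ℕ) →
            ∑[ u ∈ X ] ∑[ v ∈ Y ] f u v ≡ ∑[ v ∈ Y ] ∑[ u ∈ X ] f u v
  ∑∈-comm {m} {n} X Y f = begin
    sum (λ u → ⟦ lookup X u ⟧ * ∑∈ Y (f u))
      ≡⟨ sum-cong-≗ (λ u → *-distribˡ-sum {n} ⟦ lookup X u ⟧ _) ⟩
    sum (λ u → sum (λ v → ⟦ lookup X u ⟧ * (⟦ lookup Y v ⟧ * f u v)))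
      ≡⟨ ∑-comm {m} {n} _ ⟩
    sum (λ v → sum (λ u → ⟦ lookup X u ⟧ * (⟦ lookup Y v ⟧ * f u v)))
      ≡⟨ sum-cong-≗ (λ v → ∑∈-* X ⟦ lookup Y v ⟧ (λ u → f u v)) ⟩
    ∑[ v ∈ Y ] ∑[ u ∈ X ] f u v ∎
    where open ≡-Reasoning

  sum≡∑⊤ : (f : Fin n → ℕ) → sum f ≡ ∑∈ ⊤ f
  sum≡∑⊤ f = sum-cong-≗ (λ u → sym (trans (cong (λ b → ⟦ b ⟧ * f u) (lookup-replicate u true)) (+-identityʳ (f u))))

  sum-split : (X : Subset n) (f : Fin n → ℕ) → sum f ≡ ∑∈ X f + ∑∈ (∁ X) f
  sum-split {n} X f = trans (sum-cong-≗ term) (∑-distrib-+ {n} _ _)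
    where
    term : ∀ u → f u ≡ ⟦ lookup X u ⟧ * f u + ⟦ lookup (∁ X) u ⟧ * f u
    term u rewrite lookup-map u not X with lookup X u
    ... | true  = sym (trans (+-identityʳ _) (+-identityʳ (f u)))
    ... | false = sym (+-identityʳ (f u))

  ∑⊤-split : (X : Subset n) (f : Fin n → ℕ) → ∑∈ ⊤ f ≡ ∑∈ X f + ∑∈ (∁ X) f
  ∑⊤-split X f = trans (sym (sum≡∑⊤ f)) (sum-split X f)

  ∣∣≡sum : (X : Subset n) → ∣ X ∣ ≡ sum (λ u → ⟦ lookup X u ⟧)
  ∣∣≡sum []          = refl
  ∣∣≡sum (true  ∷ X) = cong suc (∣∣≡sum X)
  ∣∣≡sum (false ∷ X) = ∣∣≡sum X

  ∑∈-const : (X : Subset n) (c : ℕ) → ∑[ _ ∈ X ] c ≡ ∣ X ∣ * c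
  ∑∈-const {n} X c = begin
    ∑[ _ ∈ X ] c              ≡⟨ sum-cong-≗ (λ u → *-comm ⟦ lookup X u ⟧ c) ⟩
    sum (λ u → c * ⟦ lookup X u ⟧) ≡⟨ *-distribˡ-sum {n} c _ ⟨
    c * sum (λ u → ⟦ lookup X u ⟧) ≡⟨ cong (c *_) (∣∣≡sum X) ⟨
    c * ∣ X ∣                 ≡⟨ *-comm c ∣ X ∣ ⟩
    ∣ X ∣ * c                 ∎
    where open ≡-Reasoning

  -- The equality case of a termwise inequality. It turns double counts into information on single
  -- entries, both for vertices adjacent to all of `X` and in the extremal argument of
  -- `isFull<commonNbrs`.
  ∑∈-mono-≡ : (X : Subset n) {f g : Fin n → ℕ} → (∀ u → u ∈ X → f u ≤ g u) →
              ∑∈ X g ≤ ∑∈ X f → ∀ u → u ∈ X → f u ≡ g u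
  ∑∈-mono-≡ X {f} {g} f≤g Σg≤Σf u u∈X =
    +-cancelʳ-≡ 0 (f u) (g u) (subst (λ b → ⟦ b ⟧ * f u ≡ ⟦ b ⟧ * g u) ([]=⇒lookup u∈X)
      (pointwise _ _ (λ v → term v (lookup X v) refl) Σg≤Σf u))
    where
    term : ∀ v b → lookup X v ≡ b → ⟦ b ⟧ * f v ≤ ⟦ b ⟧ * g v
    term v true  v∈X = +-monoˡ-≤ 0 (f≤g v (lookup⇒[]= v X v∈X))
    term v false _   = z≤n

    sum-mono : ∀ {n} (f g : Fin n → ℕ) → (∀ v → f v ≤ g v) → sum f ≤ sum g
    sum-mono {zero}  f g f≤g = z≤n
    sum-mono {suc n} f g f≤g = +-mono-≤ (f≤g zero) (sum-mono (f ∘ suc) (g ∘ suc) (f≤g ∘ suc))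

    pointwise : ∀ {n} (f g : Fin n → ℕ) → (∀ v → f v ≤ g v) → sum g ≤ sum f → ∀ v → f v ≡ g v
    pointwise {suc n} f g f≤g Σ≤ zero = ≤-antisym (f≤g zero)
      (+-cancelʳ-≤ (sum (g ∘ suc)) _ _
        (≤-trans Σ≤ (+-monoʳ-≤ (f zero) (sum-mono (f ∘ suc) (g ∘ suc) (f≤g ∘ suc)))))
    pointwise {suc n} f g f≤g Σ≤ (suc v) = pointwise (f ∘ suc) (g ∘ suc) (f≤g ∘ suc)
      (+-cancelˡ-≤ (f zero) _ _ (≤-trans (+-monoˡ-≤ (sum (g ∘ suc)) (f≤g zero)) Σ≤)) v

  ∑∈-≤ : (X : Subset n) (f : Fin n → ℕ) → ∀ u → u ∈ X → f u ≤ ∑∈ X f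
  ∑∈-≤ X f u u∈X = subst (_≤ ∑∈ X f)
    (trans (cong (λ b → ⟦ b ⟧ * f u) ([]=⇒lookup u∈X)) (+-identityʳ (f u))) (go _ u)
    where
    go : ∀ {n} (g : Fin n → ℕ) u → g u ≤ sum g
    go g zero    = m≤m+n (g zero) _
    go g (suc u) = ≤-trans (go (g ∘ suc) u) (m≤n+m _ (g zero))

  sum-↑ : ∀ {k} (f : Fin (k + n) → ℕ) → sum f ≡ sum (λ u → f (u ↑ˡ n)) + sum (λ v → f (k ↑ʳ v))
  sum-↑ {k = zero}  f = refl
  sum-↑ {k = suc k} f = trans (cong (f zero +_) (sum-↑ {k = k} (f ∘ suc))) (sym (+-assoc (f zero) _ _))

  sum-combine : (f : Fin (m * n) → ℕ) → sum f ≡ sum (λ j → sum (λ v → f (combine {m} {n} j v)))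
  sum-combine {zero}      f = refl
  sum-combine {suc m} {n} f = trans (sum-↑ {k = n} f) (cong (sum (λ v → f (v ↑ˡ (m * n))) +_) (sum-combine {m} {n} (λ p → f (n ↑ʳ p))))

  sum-⁅⁆ : (i : Fin m) (f : Fin m → ℕ) → ∑∈ ⁅ i ⁆ f ≡ f i
  sum-⁅⁆ i f = trans (∑∈-cong ⁅ i ⁆ (λ u u∈ → cong f (x∈⁅y⁆⇒x≡y i u∈)))
    (trans (∑∈-const ⁅ i ⁆ (f i)) (trans (cong (_* f i) (∣⁅x⁆∣≡1 i)) (+-identityʳ (f i))))

  -- Neighbour counts as sums of matrix entries

  nbrsIn≡∑ : (G : Graph n) (X : Subset n) (v : Fin n) → nbrsIn G X v ≡ ∑[ u ∈ X ] entry G u v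
  nbrsIn≡∑ G X v = trans (∣∣≡sum (X ∩ nbhd G v)) (sum-cong-≗ λ u → begin
    ⟦ lookup (X ∩ nbhd G v) u ⟧        ≡⟨ cong ⟦_⟧ (lookup-zipWith _∧_ u X (nbhd G v)) ⟩
    ⟦ lookup X u ∧ lookup (nbhd G v) u ⟧ ≡⟨ cong (λ b → ⟦ lookup X u ∧ b ⟧) (trans (lookup∘tabulate (adj G v) u) (adj-sym G v u)) ⟩
    ⟦ lookup X u ∧ adj G u v ⟧         ≡⟨ ⟦⟧-∧ (lookup X u) (adj G u v) ⟩
    ⟦ lookup X u ⟧ * entry G u v ∎)
    where open ≡-Reasoning

  entry-sym : (G : Graph n) → ∀ u v → entry G u v ≡ entry G v u
  entry-sym G u v = cong ⟦_⟧ (adj-sym G u v)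

  commonNbrs≡sum : (G : Graph n) → ∀ u v → commonNbrs G u v ≡ sum (λ r → entry G u r * entry G r v)
  commonNbrs≡sum G u v = trans (∣∣≡sum (nbhd G u ∩ nbhd G v)) (sum-cong-≗ λ r → begin
    ⟦ lookup (nbhd G u ∩ nbhd G v) r ⟧        ≡⟨ cong ⟦_⟧ (lookup-zipWith _∧_ r (nbhd G u) (nbhd G v)) ⟩
    ⟦ lookup (nbhd G u) r ∧ lookup (nbhd G v) r ⟧ ≡⟨ cong₂ (λ b c → ⟦ b ∧ c ⟧) (lookup∘tabulate (adj G u) r) (trans (lookup∘tabulate (adj G v) r) (adj-sym G v r)) ⟩
    ⟦ adj G u r ∧ adj G r v ⟧         ≡⟨ ⟦⟧-∧ (adj G u r) (adj G r v) ⟩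
    entry G u r * entry G r v ∎)
    where open ≡-Reasoning

  degree≡sum : (G : Graph n) → ∀ u → degree G u ≡ sum (entry G u)
  degree≡sum G u = trans (∣∣≡sum (nbhd G u)) (sum-cong-≗ λ r → cong ⟦_⟧ (lookup∘tabulate (adj G u) r))

  commonNbrs-sym : (G : Graph n) → ∀ u v → commonNbrs G u v ≡ commonNbrs G v u
  commonNbrs-sym G u v = trans (commonNbrs≡sum G u v) (trans
    (sum-cong-≗ λ r → trans (cong₂ _*_ (entry-sym G u r) (entry-sym G r v)) (*-comm (entry G r u) _))
    (sym (commonNbrs≡sum G v u)))

  entry≤1 : (G : Graph n) → ∀ u v → entry G u v ≤ 1
  entry≤1 G u v with adj G u v
  ... | true  = ≤-refl
  ... | false = z≤n

  -- Switching a graph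

  ∉⇒lookup : {X : Subset n} {u : Fin n} → u ∉ X → lookup X u ≡ false
  ∉⇒lookup {X = X} {u} u∉X with lookup X u in eq
  ... | false = refl
  ... | true  = contradiction (lookup⇒[]= u X eq) u∉X

  module _ (G : Graph n) (X : Subset n) where

    Split : Fin n → Set
    Split v = nbrsIn G X v ≡ 0 ⊎ 2 * nbrsIn G X v ≡ ∣ X ∣ ⊎ nbrsIn G X v ≡ ∣ X ∣

    isFull : Fin n → ℕ
    isFull v = ⟦ ⌊ nbrsIn G X v ≟ ∣ X ∣ ⌋ ⟧

    private
      N = ∣ X ∣
      s = nbrsIn G X
      a = entry G
      a′ = entry (switch G X)
      ℓ = commonNbrs G
      ℓ′ = commonNbrs (switch G X)

    ∈⇒0<∣∣ : ∀ {u} → u ∈ X → 0 < N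
    ∈⇒0<∣∣ {u} u∈X = subst (1 ≤_) (trans (∑∈-const X 1) (*-identityʳ N)) (∑∈-≤ X (λ _ → 1) u u∈X)

    nbrsIn≡∑ʳ : ∀ v → s v ≡ ∑[ u ∈ X ] a v u
    nbrsIn≡∑ʳ v = trans (nbrsIn≡∑ G X v) (∑∈-cong X (λ u _ → entry-sym G u v))

    entry-none : ∀ {u} v → u ∈ X → s v ≡ 0 → a u v ≡ 0
    entry-none {u} v u∈X s≡0 =
      n≤0⇒n≡0 (subst (a u v ≤_) (trans (sym (nbrsIn≡∑ G X v)) s≡0) (∑∈-≤ X (λ w → a w v) u u∈X))

    entry-full : ∀ {u} v → u ∈ X → s v ≡ N → a u v ≡ 1
    entry-full {u} v u∈X s≡N = ∑∈-mono-≡ X (λ w _ → entry≤1 G w v)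
      (≤-reflexive (trans (∑∈-const X 1) (trans (*-identityʳ N) (trans (sym s≡N) (nbrsIn≡∑ G X v))))) u u∈X

    private
      2N≢N : 0 < N → 2 * N ≢ N
      2N≢N 0<N eq = <⇒≢ 0<N (sym (+-cancelˡ-≡ N N 0
        (trans (cong (N +_) (sym (+-identityʳ N))) (trans eq (sym (+-identityʳ N))))))

      full≢half : ∀ {v} → 0 < N → s v ≡ N → 2 * s v ≢ N
      full≢half 0<N s≡N eq = 2N≢N 0<N (trans (cong (2 *_) (sym s≡N)) eq)

      none≢ : ∀ {v} → 0 < N → s v ≡ 0 → s v ≢ N
      none≢ 0<N s≡0 s≡N = <⇒≢ 0<N (trans (sym s≡0) s≡N)

    isFull-full : ∀ {v} → s v ≡ N → isFull v ≡ 1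
    isFull-full {v} s≡N with s v ≟ N
    ... | yes _  = refl
    ... | no s≢N = contradiction s≡N s≢N

    isFull-other : ∀ {v} → s v ≢ N → isFull v ≡ 0
    isFull-other {v} s≢N with s v ≟ N
    ... | yes s≡N  = contradiction s≡N s≢N
    ... | no _ = refl

    -- The factor 2 s v / N is 0, 1 or 2, and in the two extreme cases the entry is known.
    share*entry : ∀ {u} v → u ∈ X → Split v → 2 * s v * a u v ≡ N * (a u v + isFull v)
    share*entry v u∈X (inj₁ s≡0)
      rewrite entry-none v u∈X s≡0 | isFull-other {v} (none≢ (∈⇒0<∣∣ u∈X) s≡0) | s≡0 = sym (*-zeroʳ N)
    share*entry {u} v u∈X (inj₂ (inj₁ 2s≡N))
      rewrite isFull-other {v} (λ s≡N → full≢half {v} (∈⇒0<∣∣ u∈X) s≡N 2s≡N) | +-identityʳ (a u v) = cong (_* a u v) 2s≡N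
    share*entry v u∈X (inj₂ (inj₂ s≡N))
      rewrite entry-full v u∈X s≡N | isFull-full {v} s≡N | s≡N = trans (*-identityʳ (2 * N)) (*-comm 2 N)

    ∑-nbrsIn : (Y : Subset n) (c : Fin n → ℕ) →
               ∑[ u ∈ X ] ∑[ v ∈ Y ] (c v * a u v) ≡ ∑[ v ∈ Y ] (c v * s v)
    ∑-nbrsIn Y c = trans (∑∈-comm X Y _) (∑∈-cong Y λ v _ →
      trans (∑∈-* X (c v) _) (cong (c v *_) (sym (nbrsIn≡∑ G X v))))

    ∑-commonNbrs : ∀ v → ∑[ u ∈ X ] ℓ u v ≡ ∑[ r ∈ ⊤ ] (s r * a r v)
    ∑-commonNbrs v = begin
      ∑[ u ∈ X ] ℓ u v                              ≡⟨ ∑∈-cong X (λ u _ → trans (commonNbrs≡sum G u v) (sum≡∑⊤ {n} _)) ⟩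
      ∑[ u ∈ X ] ∑[ r ∈ ⊤ ] (a u r * a r v)         ≡⟨ ∑∈-cong X (λ u _ → ∑∈-cong ⊤ (λ r _ → *-comm (a u r) (a r v))) ⟩
      ∑[ u ∈ X ] ∑[ r ∈ ⊤ ] (a r v * a u r)         ≡⟨ ∑-nbrsIn ⊤ (λ r → a r v) ⟩
      ∑[ r ∈ ⊤ ] (a r v * s r)                      ≡⟨ ∑∈-cong ⊤ (λ r _ → *-comm (a r v) (s r)) ⟩
      ∑[ r ∈ ⊤ ] (s r * a r v)                      ∎
      where open ≡-Reasoning

    module _ (Y : Subset n) (split : ∀ v → v ∈ Y → Split v)
             (D : ℕ) (constant : ∀ u → u ∈ X → ∑∈ Y (a u) ≡ D) where

      -- With M the block of the adjacency matrix with rows in `X` and columns in `Y`, the sum is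
      -- the entry at `u` of M Mᵀ applied to the all-ones vector. By `share*entry` it depends only
      -- on the row sum `D` and the number of full columns, hence not on `u`.
      ∑-share : ∀ u → u ∈ X → 2 * ∑[ v ∈ Y ] (s v * a u v) ≡ N * (D + ∑∈ Y isFull)
      ∑-share u u∈X = begin
        2 * ∑[ v ∈ Y ] (s v * a u v)        ≡⟨ ∑∈-* Y 2 _ ⟨
        ∑[ v ∈ Y ] (2 * (s v * a u v))      ≡⟨ ∑∈-cong Y (λ v v∈Y → trans (sym (*-assoc 2 (s v) (a u v))) (share*entry v u∈X (split v v∈Y))) ⟩
        ∑[ v ∈ Y ] (N * (a u v + isFull v)) ≡⟨ ∑∈-* Y N _ ⟩
        N * ∑[ v ∈ Y ] (a u v + isFull v)   ≡⟨ cong (N *_) (∑∈-+ Y (a u) isFull) ⟩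
        N * (∑∈ Y (a u) + ∑∈ Y isFull)      ≡⟨ cong (λ d → N * (d + ∑∈ Y isFull)) (constant u u∈X) ⟩
        N * (D + ∑∈ Y isFull)               ∎
        where open ≡-Reasoning

      -- By `∑-share` the entries of M Mᵀ applied to the all-ones vector are all equal, so |X| times
      -- one of them is their total, which is then counted by columns.
      ∑-share-constant : ∀ u → u ∈ X → N * ∑[ v ∈ Y ] (s v * a u v) ≡ ∑[ v ∈ Y ] (s v * s v)
      ∑-share-constant u u∈X = *-cancelˡ-≡ _ _ 2 (begin
        2 * (N * ∑[ v ∈ Y ] (s v * a u v))             ≡⟨ x*yz≈y*xz 2 N _ ⟩
        N * (2 * ∑[ v ∈ Y ] (s v * a u v))             ≡⟨ ∑∈-const X _ ⟨
        ∑[ _ ∈ X ] (2 * ∑[ v ∈ Y ] (s v * a u v))      ≡⟨ ∑∈-cong X (λ w w∈X → trans (∑-share u u∈X) (sym (∑-share w w∈X))) ⟩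
        ∑[ w ∈ X ] (2 * ∑[ v ∈ Y ] (s v * a w v))      ≡⟨ ∑∈-* X 2 _ ⟩
        2 * ∑[ w ∈ X ] ∑[ v ∈ Y ] (s v * a w v)        ≡⟨ cong (2 *_) (∑-nbrsIn Y s) ⟩
        2 * ∑[ v ∈ Y ] (s v * s v)                     ∎)
        where
        open ≡-Reasoning

    lookup-halfSet : ∀ v → lookup (halfSet G X) v ≡ not (lookup X v) ∧ ⌊ 2 * s v ≟ N ⌋
    lookup-halfSet v = trans (lookup-zipWith _∧_ v (∁ X) _) (cong₂ _∧_ (lookup-map v not X) (lookup∘tabulate _ v))

    switch-inside : ∀ {u v} → u ∈ X → v ∈ X → a′ u v ≡ a u v
    switch-inside {u} {v} u∈X v∈X
      rewrite lookup-halfSet u | lookup-halfSet v | []=⇒lookup u∈X | []=⇒lookup v∈X = refl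

    switch-outside : ∀ {u v} → u ∉ X → v ∉ X → a′ u v ≡ a u v
    switch-outside u∉X v∉X rewrite ∉⇒lookup u∉X | ∉⇒lookup v∉X = refl

    -- The reflection a′ = 2 s / |X| - a, cleared of its denominator. In a half column the mean is
    -- 1/2 and the entry flips; in an empty or full column every entry already equals the mean and
    -- stays.
    switch-cross : ∀ {u v} → u ∈ X → v ∉ X → Split v → N * (a′ u v + a u v) ≡ 2 * s v
    switch-cross {u} {v} u∈X v∉X split
      rewrite lookup-halfSet u | lookup-halfSet v | []=⇒lookup u∈X | ∉⇒lookup v∉X
      with 2 * s v ≟ N | split
    ... | yes 2s≡N | _                 = trans (cong (N *_) (flip (adj G u v))) (trans (*-identityʳ N) (sym 2s≡N))
      where
      flip : ∀ b → ⟦ not b ⟧ + ⟦ b ⟧ ≡ 1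
      flip true  = refl
      flip false = refl
    ... | no  2s≢N | inj₁ s≡0          = trans (cong (λ e → N * (e + e)) (entry-none v u∈X s≡0)) (trans (*-zeroʳ N) (cong (2 *_) (sym s≡0)))
    ... | no  2s≢N | inj₂ (inj₁ 2s≡N)  = contradiction 2s≡N 2s≢N
    ... | no  2s≢N | inj₂ (inj₂ s≡N)   = trans (cong (λ e → N * (e + e)) (entry-full v u∈X s≡N)) (trans (*-comm N 2) (cong (2 *_) (sym s≡N)))

    module _ (S : IsSwitchingSet G X) where
      open IsSwitchingSet S

      switch-cross′ : ∀ {u v} → u ∈ X → v ∉ X → N * (a′ v u + a v u) ≡ 2 * s v
      switch-cross′ {u} {v} u∈X v∉X = trans
        (cong (N *_) (cong₂ _+_ (entry-sym (switch G X) v u) (entry-sym G v u)))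
        (switch-cross u∈X v∉X (outside v v∉X))

      -- This is the off-diagonal block of Q A² Q: the column of λ at `v` is reflected in its mean
      -- over `X`. For each middle vertex `r`, exactly one of the pairs `u`, `r` and `r`, `v`
      -- crosses between `X` and its complement, so the relation of `switch-cross` is applied once
      -- per term.
      commonNbrs-cross : ∀ {u v} → u ∈ X → v ∉ X → N * (ℓ′ u v + ℓ u v) ≡ 2 * ∑[ w ∈ X ] ℓ w v
      commonNbrs-cross {u} {v} u∈X v∉X = begin
        N * (ℓ′ u v + ℓ u v)
          ≡⟨ cong (N *_) (cong₂ _+_ (commonNbrs≡sum (switch G X) u v) (commonNbrs≡sum G u v)) ⟩
        N * (sum (λ r → a′ u r * a′ r v) + sum (λ r → a u r * a r v))
          ≡⟨ cong (N *_) (trans (sym (∑-distrib-+ {n} _ _)) (sum-split X both)) ⟩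
        N * (∑∈ X both + ∑∈ (∁ X) both)
          ≡⟨ *-distribˡ-+ N _ _ ⟩
        N * ∑∈ X both + N * ∑∈ (∁ X) both
          ≡⟨ cong₂ _+_ (∑∈-* X N both) (∑∈-* (∁ X) N both) ⟨
        ∑[ r ∈ X ] (N * both r) + ∑[ r ∈ ∁ X ] (N * both r)
          ≡⟨ cong₂ _+_ (∑∈-cong X in-X) (∑∈-cong (∁ X) out-X) ⟩
        ∑[ r ∈ X ] (2 * s v * a u r) + ∑[ r ∈ ∁ X ] (2 * (s r * a r v))
          ≡⟨ cong₂ _+_ (trans (∑∈-* X (2 * s v) (a u)) (cong (2 * s v *_) (sym (nbrsIn≡∑ʳ u)))) (∑∈-* (∁ X) 2 _) ⟩
        2 * s v * s u + 2 * ∑[ r ∈ ∁ X ] (s r * a r v)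
          ≡⟨ cong (_+ 2 * ∑[ r ∈ ∁ X ] (s r * a r v)) (rearrange (s v) (s u)) ⟩
        2 * (s u * s v) + 2 * ∑[ r ∈ ∁ X ] (s r * a r v)
          ≡⟨ *-distribˡ-+ 2 (s u * s v) _ ⟨
        2 * (s u * s v + ∑[ r ∈ ∁ X ] (s r * a r v))
          ≡⟨ cong (λ t → 2 * (t + ∑[ r ∈ ∁ X ] (s r * a r v))) in-sum ⟨
        2 * (∑[ r ∈ X ] (s r * a r v) + ∑[ r ∈ ∁ X ] (s r * a r v))
          ≡⟨ cong (2 *_) (trans (∑-commonNbrs v) (∑⊤-split X _)) ⟨
        2 * ∑[ w ∈ X ] ℓ w v ∎
        where
        open ≡-Reasoning
        both : Fin n → ℕ
        both r = a′ u r * a′ r v + a u r * a r v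

        rearrange : ∀ x y → 2 * x * y ≡ 2 * (y * x)
        rearrange = solve-∀

        factorˡ : ∀ M x y z → M * (x * y + x * z) ≡ M * (y + z) * x
        factorˡ = solve-∀

        factorʳ : ∀ M x y z → M * (x * z + y * z) ≡ M * (x + y) * z
        factorʳ = solve-∀

        in-X : ∀ r → r ∈ X → N * both r ≡ 2 * s v * a u r
        in-X r r∈X = trans (cong (λ e → N * (e * a′ r v + a u r * a r v)) (switch-inside u∈X r∈X))
          (trans (factorˡ N (a u r) (a′ r v) (a r v))
                 (cong (_* a u r) (switch-cross r∈X v∉X (outside v v∉X))))

        out-X : ∀ r → r ∈ ∁ X → N * both r ≡ 2 * (s r * a r v)
        out-X r r∈∁X = trans (cong (λ e → N * (a′ u r * e + a u r * a r v)) (switch-outside r∉X v∉X))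
          (trans (factorʳ N (a′ u r) (a u r) (a r v))
          (trans (cong (_* a r v) (switch-cross u∈X r∉X (outside r r∉X))) (*-assoc 2 (s r) (a r v))))
          where r∉X = x∈∁p⇒x∉p r∈∁X

        -- Regularity of `X` lets `s r` replace `s u`, so that the middle vertices in `X` and those
        -- outside contribute terms of the same shape to one sum over all vertices.
        in-sum : ∑[ r ∈ X ] (s r * a r v) ≡ s u * s v
        in-sum = trans (∑∈-cong X (λ r r∈X → cong (_* a r v)
            (trans (proj₂ regular r r∈X) (sym (proj₂ regular u u∈X)))))
          (trans (∑∈-* X (s u) _) (cong (s u *_) (sym (nbrsIn≡∑ G X v))))

      private
        -- x′ y′ = (2σ/M − x) (2τ/M − y), expanded with no division or subtraction.
        reflect : ∀ {M x x′ y y′ σ τ} → M * (x′ + x) ≡ 2 * σ → M * (y′ + y) ≡ 2 * τ →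
                  M * M * (x′ * y′) + (2 * M * (σ * y) + 2 * M * (τ * x)) ≡ 4 * (σ * τ) + M * M * (x * y)
        reflect {M} {x} {x′} {y} {y′} {σ} {τ} p q = begin
          M * M * (x′ * y′) + (2 * M * (σ * y) + 2 * M * (τ * x))
            ≡⟨ shape₁ M (x′ * y′) σ τ x y ⟩
          M * M * (x′ * y′) + (M * (2 * σ) * y + M * (2 * τ) * x)
            ≡⟨ cong₂ (λ e f → M * M * (x′ * y′) + (M * e * y + M * f * x)) p q ⟨
          M * M * (x′ * y′) + (M * (M * (x′ + x)) * y + M * (M * (y′ + y)) * x)
            ≡⟨ shape₂ M x x′ y y′ ⟩
          M * (x′ + x) * (M * (y′ + y)) + M * M * (x * y)
            ≡⟨ cong₂ (λ e f → e * f + M * M * (x * y)) p q ⟩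
          2 * σ * (2 * τ) + M * M * (x * y)
            ≡⟨ cong (_+ M * M * (x * y)) (shape₃ σ τ) ⟩
          4 * (σ * τ) + M * M * (x * y) ∎
          where
          open ≡-Reasoning
          shape₁ : ∀ M z σ τ x y → M * M * z + (2 * M * (σ * y) + 2 * M * (τ * x)) ≡
                                   M * M * z + (M * (2 * σ) * y + M * (2 * τ) * x)
          shape₁ = solve-∀
          shape₂ : ∀ M x x′ y y′ → M * M * (x′ * y′) + (M * (M * (x′ + x)) * y + M * (M * (y′ + y)) * x) ≡
                                   M * (x′ + x) * (M * (y′ + y)) + M * M * (x * y)
          shape₂ = solve-∀
          shape₃ : ∀ σ τ → 2 * σ * (2 * τ) ≡ 4 * (σ * τ)
          shape₃ = solve-∀

        -- On summing `reflect`, each of the two mixed terms becomes twice the sum of σ τ by one of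
        -- the last two hypotheses. Together they cancel 4 σ τ, and the inner product of the two
        -- rows is unchanged.
        reflect-∑ : (Y : Subset n) {x x′ y y′ σ τ : Fin n → ℕ} → 0 < N →
          (∀ r → r ∈ Y → N * (x′ r + x r) ≡ 2 * σ r) →
          (∀ r → r ∈ Y → N * (y′ r + y r) ≡ 2 * τ r) →
          N * ∑[ r ∈ Y ] (σ r * y r) ≡ ∑[ r ∈ Y ] (σ r * τ r) →
          N * ∑[ r ∈ Y ] (τ r * x r) ≡ ∑[ r ∈ Y ] (σ r * τ r) →
          ∑[ r ∈ Y ] (x′ r * y′ r) ≡ ∑[ r ∈ Y ] (x r * y r)
        reflect-∑ Y {x} {x′} {y} {y′} {σ} {τ} 0<N p q σy τx =
          *-cancelˡ-≡ _ _ (N * N) {{m*n≢0 N N}} (+-cancelʳ-≡ (4 * Στ) _ _ (begin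
            N * N * ∑[ r ∈ Y ] (x′ r * y′ r) + 4 * Στ
              ≡⟨ cong (N * N * ∑[ r ∈ Y ] (x′ r * y′ r) +_) four ⟩
            N * N * ∑[ r ∈ Y ] (x′ r * y′ r) + (2 * N * ∑[ r ∈ Y ] (σ r * y r) + 2 * N * ∑[ r ∈ Y ] (τ r * x r))
              ≡⟨ cong₂ _+_ (∑∈-* Y (N * N) _) (cong₂ _+_ (∑∈-* Y (2 * N) _) (∑∈-* Y (2 * N) _)) ⟨
            ∑[ r ∈ Y ] (N * N * (x′ r * y′ r)) + (∑[ r ∈ Y ] (2 * N * (σ r * y r)) + ∑[ r ∈ Y ] (2 * N * (τ r * x r)))
              ≡⟨ trans (∑∈-+ Y switched (λ r → 2 * N * (σ r * y r) + 2 * N * (τ r * x r)))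
                   (cong (∑∈ Y switched +_) (∑∈-+ Y (λ r → 2 * N * (σ r * y r)) _)) ⟨
            ∑[ r ∈ Y ] (N * N * (x′ r * y′ r) + (2 * N * (σ r * y r) + 2 * N * (τ r * x r)))
              ≡⟨ ∑∈-cong Y (λ r r∈Y → reflect {N} {x r} {x′ r} {y r} {y′ r} {σ r} {τ r} (p r r∈Y) (q r r∈Y)) ⟩
            ∑[ r ∈ Y ] (4 * (σ r * τ r) + N * N * (x r * y r))
              ≡⟨ trans (∑∈-+ Y (λ r → 4 * (σ r * τ r)) _) (cong₂ _+_ (∑∈-* Y 4 _) (∑∈-* Y (N * N) _)) ⟩
            4 * Στ + N * N * ∑[ r ∈ Y ] (x r * y r)
              ≡⟨ +-comm (4 * Στ) _ ⟩
            N * N * ∑[ r ∈ Y ] (x r * y r) + 4 * Στ ∎))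
          where
          open ≡-Reasoning
          instance
            N≢0 : NonZero N
            N≢0 = >-nonZero 0<N
          switched : Fin n → ℕ
          switched r = N * N * (x′ r * y′ r)
          Στ : ℕ
          Στ = ∑[ r ∈ Y ] (σ r * τ r)
          double : ∀ z → 4 * z ≡ 2 * z + 2 * z
          double = solve-∀
          four : 4 * Στ ≡ 2 * N * ∑[ r ∈ Y ] (σ r * y r) + 2 * N * ∑[ r ∈ Y ] (τ r * x r)
          four = trans (double Στ) (cong₂ _+_
            (trans (cong (2 *_) (sym σy)) (sym (*-assoc 2 N _)))
            (trans (cong (2 *_) (sym τx)) (sym (*-assoc 2 N _))))

      -- Through a middle vertex in `X` both factors are reflected, with means that do not depend on
      -- that vertex. The balance required by `reflect-∑` is then just the definition of `s` as a
      -- column sum.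
      commonNbrs-outside : ∀ {u v} → 0 < N → u ∉ X → v ∉ X → ℓ′ u v ≡ ℓ u v
      commonNbrs-outside {u} {v} 0<N u∉X v∉X = begin
        ℓ′ u v ≡⟨ trans (commonNbrs≡sum (switch G X) u v) (sum-split X _) ⟩
        ∑[ r ∈ X ] (a′ u r * a′ r v) + ∑[ r ∈ ∁ X ] (a′ u r * a′ r v)
          ≡⟨ cong₂ _+_
               (reflect-∑ X {σ = λ _ → s u} {τ = λ _ → s v} 0<N
                 (λ r r∈X → switch-cross′ r∈X u∉X)
                 (λ r r∈X → switch-cross r∈X v∉X (outside v v∉X))
                 (trans (cong (N *_) (trans (∑∈-* X (s u) _) (cong (s u *_) (sym (nbrsIn≡∑ G X v))))) (sym (∑∈-const X _)))
                 (trans (cong (N *_) (trans (∑∈-* X (s v) _) (trans (cong (s v *_) (sym (nbrsIn≡∑ʳ u))) (*-comm (s v) (s u))))) (sym (∑∈-const X _))))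
               (∑∈-cong (∁ X) (λ r r∈∁X → cong₂ _*_
                 (switch-outside u∉X (x∈∁p⇒x∉p r∈∁X)) (switch-outside (x∈∁p⇒x∉p r∈∁X) v∉X))) ⟩
        ∑[ r ∈ X ] (a u r * a r v) + ∑[ r ∈ ∁ X ] (a u r * a r v)
          ≡⟨ trans (commonNbrs≡sum G u v) (sum-split X _) ⟨
        ℓ u v ∎
        where open ≡-Reasoning

      -- Here the doubly reflected middle vertices lie outside `X` and the means vary with them, so
      -- the balance is the constancy of M Mᵀ applied to the all-ones vector. Equal degrees together
      -- with regularity of `X` give M the constant row sum that `∑-share-constant` asks for.
      commonNbrs-inside : (∀ u v → u ∈ X → v ∈ X → degree G u ≡ degree G v) →
                          ∀ {u v} → u ∈ X → v ∈ X → ℓ′ u v ≡ ℓ u v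
      commonNbrs-inside equidegree {u} {v} u∈X v∈X = begin
        ℓ′ u v ≡⟨ trans (commonNbrs≡sum (switch G X) u v) (sum-split X _) ⟩
        ∑[ r ∈ X ] (a′ u r * a′ r v) + ∑[ r ∈ ∁ X ] (a′ u r * a′ r v)
          ≡⟨ cong₂ _+_
               (∑∈-cong X (λ r r∈X → cong₂ _*_ (switch-inside u∈X r∈X) (switch-inside r∈X v∈X)))
               (reflect-∑ (∁ X) {σ = s} {τ = s} (∈⇒0<∣∣ u∈X)
                 (λ r r∈∁X → switch-cross u∈X (x∈∁p⇒x∉p r∈∁X) (outside r (x∈∁p⇒x∉p r∈∁X)))
                 (λ r r∈∁X → switch-cross′ v∈X (x∈∁p⇒x∉p r∈∁X))
                 (trans (cong (N *_) (∑∈-cong (∁ X) (λ r _ → cong (s r *_) (entry-sym G r v)))) (share v∈X))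
                 (share u∈X)) ⟩
        ∑[ r ∈ X ] (a u r * a r v) + ∑[ r ∈ ∁ X ] (a u r * a r v)
          ≡⟨ trans (commonNbrs≡sum G u v) (sum-split X _) ⟨
        ℓ u v ∎
        where
        open ≡-Reasoning
        degree-split : ∀ w → degree G w ≡ s w + ∑∈ (∁ X) (a w)
        degree-split w = trans (degree≡sum G w)
          (trans (sum-split X (a w)) (cong (_+ ∑∈ (∁ X) (a w)) (sym (nbrsIn≡∑ʳ w))))

        constant : ∀ w → w ∈ X → ∑∈ (∁ X) (a w) ≡ ∑∈ (∁ X) (a u)
        constant w w∈X = +-cancelˡ-≡ (s u) _ _ (begin
          s u + ∑∈ (∁ X) (a w) ≡⟨ cong (_+ ∑∈ (∁ X) (a w)) (trans (proj₂ regular u u∈X) (sym (proj₂ regular w w∈X))) ⟩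
          s w + ∑∈ (∁ X) (a w) ≡⟨ degree-split w ⟨
          degree G w           ≡⟨ equidegree w u w∈X u∈X ⟩
          degree G u           ≡⟨ degree-split u ⟩
          s u + ∑∈ (∁ X) (a u) ∎)

        share : ∀ {w} → w ∈ X → N * ∑[ r ∈ ∁ X ] (s r * a w r) ≡ ∑[ r ∈ ∁ X ] (s r * s r)
        share {w} = ∑-share-constant (∁ X) (λ r r∈∁X → outside r (x∈∁p⇒x∉p r∈∁X)) _ constant w

    module _ (split : ∀ v → Split v) (d : ℕ) (degree-d : ∀ u → u ∈ X → degree G u ≡ d) where

      -- Since `split` holds on `X` too, `∑-share` applies with all vertices as columns, and the row
      -- sum is then the degree `d`. This evaluates the mean in which the copies of `X` in other
      -- layers are reflected.
      ∑-commonNbrs-inside : ∀ {v} → v ∈ X →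
        2 * ∑[ u ∈ X ] ℓ u v ≡ N * (d + ∑∈ ⊤ isFull)
      ∑-commonNbrs-inside {v} v∈X = trans
        (cong (2 *_) (trans (∑-commonNbrs v) (∑∈-cong ⊤ (λ r _ → cong (s r *_) (entry-sym G r v)))))
        (∑-share ⊤ (λ r _ → split r) d (λ u u∈X → trans (sym (sum≡∑⊤ (a u))) (trans (sym (degree≡sum G u)) (degree-d u u∈X))) v v∈X)

      module _ (P : Subset n) (nonempty : Nonempty P) (half : ∀ w → w ∈ P → 2 * s w ≡ N)
               (noncomplementary : NoComplementaryRows G X P) where

        -- If equality held, then isFull r ≡ a u r * a r v for all r, so that
        -- |X| (a u r + a v r) ≤ 2 s r; both sides have the same sum over r, and equality
        -- for the columns in P makes the rows u and v complementary.
        isFull<commonNbrs : ∀ {u v} → u ∈ X → v ∈ X → ∑∈ ⊤ isFull < ℓ u v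
        isFull<commonNbrs {u} {v} u∈X v∈X with ∑∈ ⊤ isFull <? ℓ u v
        ... | yes lt = lt
        ... | no ≮   = contradiction complementary impossible
          where
          open ≡-Reasoning
          0<N : 0 < N
          0<N = ∈⇒0<∣∣ u∈X

          isFull≤ : ∀ r → isFull r ≤ a u r * a r v
          isFull≤ r with split r
          ... | inj₁ s≡0 = subst (_≤ a u r * a r v) (sym (isFull-other {r} (none≢ {r} 0<N s≡0))) z≤n
          ... | inj₂ (inj₁ 2s≡N) = subst (_≤ a u r * a r v) (sym (isFull-other {r} (λ s≡N → full≢half {r} 0<N s≡N 2s≡N))) z≤n
          ... | inj₂ (inj₂ s≡N) = ≤-reflexive (trans (isFull-full {r} s≡N)
            (sym (cong₂ _*_ (entry-full r u∈X s≡N) (trans (entry-sym G r v) (entry-full r v∈X s≡N)))))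

          isFull≡ : ∀ r → isFull r ≡ a u r * a r v
          isFull≡ r = ∑∈-mono-≡ ⊤ (λ r _ → isFull≤ r)
            (subst (_≤ ∑∈ ⊤ isFull) (trans (commonNbrs≡sum G u v) (sum≡∑⊤ {n} _)) (≮⇒≥ ≮)) r ∈⊤

          disjoint : ∀ b c → 0 ≡ ⟦ b ⟧ * ⟦ c ⟧ → ⟦ b ⟧ + ⟦ c ⟧ ≤ 1
          disjoint true  false _ = ≤-refl
          disjoint false true  _ = ≤-refl
          disjoint false false _ = z≤n

          bound : ∀ r → N * (a u r + a v r) ≤ 2 * s r
          bound r with split r
          ... | inj₁ s≡0 = ≤-reflexive (trans
            (cong (N *_) (cong₂ _+_ (entry-none r u∈X s≡0) (entry-none r v∈X s≡0)))
            (trans (*-zeroʳ N) (cong (2 *_) (sym s≡0))))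
          ... | inj₂ (inj₂ s≡N) = ≤-reflexive (trans
            (cong (N *_) (cong₂ _+_ (entry-full r u∈X s≡N) (entry-full r v∈X s≡N)))
            (trans (*-comm N 2) (cong (2 *_) (sym s≡N))))
          ... | inj₂ (inj₁ 2s≡N) = subst (N * (a u r + a v r) ≤_) (trans (*-identityʳ N) (sym 2s≡N))
            (*-monoʳ-≤ N (disjoint (adj G u r) (adj G v r)
              (trans (sym (isFull-other {r} (λ s≡N → full≢half {r} 0<N s≡N 2s≡N)))
                     (trans (isFull≡ r) (cong (a u r *_) (entry-sym G r v))))))

          total : ∑[ r ∈ ⊤ ] (2 * s r) ≡ ∑[ r ∈ ⊤ ] (N * (a u r + a v r))
          total = begin
            ∑[ r ∈ ⊤ ] (2 * s r)                   ≡⟨ ∑-nbrsIn ⊤ (λ _ → 2) ⟨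
            ∑[ w ∈ X ] ∑[ r ∈ ⊤ ] (2 * a w r)      ≡⟨ ∑∈-cong X (λ w w∈X → trans (∑∈-* ⊤ 2 (a w)) (cong (2 *_) (row w∈X))) ⟩
            ∑[ _ ∈ X ] (2 * d)                     ≡⟨ ∑∈-const X (2 * d) ⟩
            N * (2 * d)                            ≡⟨ cong (λ e → N * (d + e)) (+-identityʳ d) ⟩
            N * (d + d)                            ≡⟨ cong (N *_) (cong₂ _+_ (row u∈X) (row v∈X)) ⟨
            N * (∑∈ ⊤ (a u) + ∑∈ ⊤ (a v))          ≡⟨ cong (N *_) (∑∈-+ ⊤ (a u) (a v)) ⟨
            N * ∑[ r ∈ ⊤ ] (a u r + a v r)         ≡⟨ ∑∈-* (⊤ {n}) N (λ r → a u r + a v r) ⟨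
            ∑[ r ∈ ⊤ ] (N * (a u r + a v r))       ∎
            where
            row : ∀ {w} → w ∈ X → ∑∈ ⊤ (a w) ≡ d
            row {w} w∈X = trans (sym (sum≡∑⊤ (a w))) (trans (sym (degree≡sum G w)) (degree-d w w∈X))

          complementary : ComplementaryOn G P u v
          complementary w w∈P = *-cancelˡ-≡ _ _ N {{>-nonZero 0<N}} (begin
            N * (a u w + a v w) ≡⟨ ∑∈-mono-≡ ⊤ (λ r _ → bound r) (≤-reflexive total) w ∈⊤ ⟩
            2 * s w             ≡⟨ half w w∈P ⟩
            N                   ≡⟨ *-identityʳ N ⟨
            N * 1               ∎)

          odd : ∀ b → ⟦ b ⟧ + ⟦ b ⟧ ≢ 1
          odd true  ()
          odd false ()

          impossible : ¬ ComplementaryOn G P u v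
          impossible with u Fin.≟ v
          ... | no u≢v   = noncomplementary u v u∈X v∈X u≢v
          -- `noncomplementary` speaks of distinct rows. A row is never complementary to itself,
          -- because `P` has a column and twice an entry is not 1.
          ... | yes refl = λ comp → odd (adj G u (proj₁ nonempty)) (comp _ (proj₂ nonempty))

  -- Reflecting numbers in their mean preserves their sum.
  nbrsIn-switch : (G : Graph n) (X : Subset n) → 0 < ∣ X ∣ → IsSwitchingSet G X →
                  ∀ v → nbrsIn (switch G X) X v ≡ nbrsIn G X v
  nbrsIn-switch G X 0<N S v with v ∈? X
  ... | yes v∈X = trans (nbrsIn≡∑ (switch G X) X v)
    (trans (∑∈-cong X (λ u u∈X → switch-inside G X u∈X v∈X)) (sym (nbrsIn≡∑ G X v)))
  ... | no  v∉X = +-cancelʳ-≡ s s′ s (*-cancelˡ-≡ _ _ N {{>-nonZero 0<N}} (begin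
      N * (s′ + s)
        ≡⟨ cong (N *_) (cong₂ _+_ (nbrsIn≡∑ (switch G X) X v) (nbrsIn≡∑ G X v)) ⟩
      N * (∑[ u ∈ X ] entry (switch G X) u v + ∑[ u ∈ X ] entry G u v)
        ≡⟨ trans (∑∈-* X N _) (cong (N *_) (∑∈-+ X (λ u → entry (switch G X) u v) _)) ⟨
      ∑[ u ∈ X ] (N * (entry (switch G X) u v + entry G u v))
        ≡⟨ ∑∈-cong X (λ u u∈X → switch-cross G X u∈X v∉X (IsSwitchingSet.outside S v v∉X)) ⟩
      ∑[ u ∈ X ] (2 * s)
        ≡⟨ ∑∈-const X (2 * s) ⟩
      N * (2 * s)
        ≡⟨ cong (λ t → N * (s + t)) (+-identityʳ s) ⟩
      N * (s + s) ∎))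
    where
    open ≡-Reasoning
    N = ∣ X ∣
    s = nbrsIn G X v
    s′ = nbrsIn (switch G X) X v

  -- Isomorphism invariants

  ∑-elements : (X : Subset n) (φ : Fin n → ℕ) → sumˡ (map φ (elements X)) ≡ ∑∈ X φ
  ∑-elements {n} X φ = trans (filtered id) (sum-cong-≗ λ u → cong (λ b → ⟦ b ⟧ * φ u) (does-∈? u))
    where
    filtered : ∀ {k} (h : Fin k → Fin n) → sumˡ (map φ (filter (_∈? X) (tabulateˡ h))) ≡
               sum (λ v → ⟦ does (h v ∈? X) ⟧ * φ (h v))
    filtered {zero}  h = refl
    filtered {suc k} h with does (h zero ∈? X)
    ... | true  = cong₂ _+_ (sym (+-identityʳ _)) (filtered (h ∘ suc))
    ... | false = filtered (h ∘ suc)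

    does-∈? : ∀ u → does (u ∈? X) ≡ lookup X u
    does-∈? u with u ∈? X
    ... | yes u∈X = sym ([]=⇒lookup u∈X)
    ... | no  u∉X = sym (∉⇒lookup u∉X)

  sum-cartesianProductWith : ∀ {A B : Set} (φ : ℕ → ℕ) (f : A → B → ℕ) (xs : List A) (ys : List B) →
    sumˡ (map φ (cartesianProductWith f xs ys)) ≡ sumˡ (map (λ x → sumˡ (map (φ ∘ f x) ys)) xs)
  sum-cartesianProductWith φ f []       ys = refl
  sum-cartesianProductWith φ f (x ∷ xs) ys = begin
    sumˡ (map φ (map (f x) ys ++ cartesianProductWith f xs ys))
      ≡⟨ cong sumˡ (map-++ φ (map (f x) ys) _) ⟩
    sumˡ (map φ (map (f x) ys) ++ map φ (cartesianProductWith f xs ys))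
      ≡⟨ sum-++ (map φ (map (f x) ys)) _ ⟩
    sumˡ (map φ (map (f x) ys)) + sumˡ (map φ (cartesianProductWith f xs ys))
      ≡⟨ cong₂ _+_ (cong sumˡ (sym (map-∘ ys))) (sum-cartesianProductWith φ f xs ys) ⟩
    sumˡ (map (φ ∘ f x) ys) + sumˡ (map (λ x → sumˡ (map (φ ∘ f x) ys)) xs) ∎
    where open ≡-Reasoning

  -- Brings the hypothesis on multisets into the language of sums: a permutation of lists preserves
  -- the sum of any test function φ.
  ∑-Λ̄ : (G : Graph n) (X : Subset n) (φ : ℕ → ℕ) →
        sumˡ (map φ (Λ̄ G X)) ≡ ∑[ u ∈ X ] ∑[ v ∈ ∁ X ] φ (commonNbrs G u v)
  ∑-Λ̄ G X φ = trans (sum-cartesianProductWith φ (commonNbrs G) (elements X) (elements (∁ X)))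
    (trans (∑-elements X _) (∑∈-cong X (λ u _ → ∑-elements (∁ X) _)))

  commonNbrs-≅ : {G G′ : Graph n} ((π , _) : G ≅ G′) → ∀ u v →
                 commonNbrs G u v ≡ commonNbrs G′ (π ⟨$⟩ʳ u) (π ⟨$⟩ʳ v)
  commonNbrs-≅ {n} {G} {G′} (π , iso) u v = begin
    commonNbrs G u v                         ≡⟨ commonNbrs≡sum G u v ⟩
    sum (λ r → entry G u r * entry G r v)    ≡⟨ sum-cong-≗ (λ r → cong₂ (λ b c → ⟦ b ⟧ * ⟦ c ⟧) (iso u r) (iso r v)) ⟩
    sum (λ r → entry G′ (π ⟨$⟩ʳ u) (π ⟨$⟩ʳ r) * entry G′ (π ⟨$⟩ʳ r) (π ⟨$⟩ʳ v))
      ≡⟨ sum-permute {n} {n} _ π ⟨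
    sum (λ r → entry G′ (π ⟨$⟩ʳ u) r * entry G′ r (π ⟨$⟩ʳ v)) ≡⟨ commonNbrs≡sum G′ _ _ ⟨
    commonNbrs G′ (π ⟨$⟩ʳ u) (π ⟨$⟩ʳ v)      ∎
    where open ≡-Reasoning

  ∑-commonNbrs-≅ : {G G′ : Graph n} → G ≅ G′ → (φ : ℕ → ℕ) →
    sum (λ u → sum (λ v → φ (commonNbrs G u v))) ≡ sum (λ u → sum (λ v → φ (commonNbrs G′ u v)))
  ∑-commonNbrs-≅ {n} {G} {G′} iso@(π , _) φ = begin
    sum (λ u → sum (λ v → φ (commonNbrs G u v)))
      ≡⟨ sum-cong-≗ (λ u → sum-cong-≗ (λ v → cong φ (commonNbrs-≅ {G = G} {G′} iso u v))) ⟩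
    sum (λ u → sum (λ v → φ (commonNbrs G′ (π ⟨$⟩ʳ u) (π ⟨$⟩ʳ v))))
      ≡⟨ sum-cong-≗ {n} (λ u → sym (sum-permute {n} {n} _ π)) ⟩
    sum (λ u → sum (λ v → φ (commonNbrs G′ (π ⟨$⟩ʳ u) v)))
      ≡⟨ sum-permute {n} {n} _ π ⟨
    sum (λ u → sum (λ v → φ (commonNbrs G′ u v))) ∎
    where open ≡-Reasoning

  -- An isomorphism fixes only the total over all pairs, with no regard to `Z`. Removing the two
  -- diagonal blocks, where the graphs agree, leaves the cross block twice, by symmetry.
  cross-sum : (Z : Subset n) (f g : Fin n → Fin n → ℕ) →
    (∀ u v → f u v ≡ f v u) → (∀ u v → g u v ≡ g v u) →
    (∀ u v → u ∈ Z → v ∈ Z → f u v ≡ g u v) → (∀ u v → u ∈ ∁ Z → v ∈ ∁ Z → f u v ≡ g u v) →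
    sum (λ u → sum (f u)) ≡ sum (λ u → sum (g u)) →
    ∑[ u ∈ Z ] ∑[ v ∈ ∁ Z ] f u v ≡ ∑[ u ∈ Z ] ∑[ v ∈ ∁ Z ] g u v
  cross-sum {n} Z f g f-sym g-sym inside outside eq = *-cancelˡ-≡ _ _ 2
    (+-cancelˡ-≡ (∑[ u ∈ Z ] ∑[ v ∈ Z ] f u v + ∑[ u ∈ ∁ Z ] ∑[ v ∈ ∁ Z ] f u v) _ _
      (trans (sym (blocks f f-sym)) (trans eq (trans (blocks g g-sym) (cong (_+ 2 * ∑[ u ∈ Z ] ∑[ v ∈ ∁ Z ] g u v)
        (cong₂ _+_ (∑∈-cong Z λ u u∈ → ∑∈-cong Z λ v v∈ → sym (inside u v u∈ v∈))
                   (∑∈-cong (∁ Z) λ u u∈ → ∑∈-cong (∁ Z) λ v v∈ → sym (outside u v u∈ v∈))))))))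
    where
    open ≡-Reasoning
    regroup : ∀ a b d → (a + b) + (b + d) ≡ (a + d) + 2 * b
    regroup = solve-∀

    blocks : (h : Fin n → Fin n → ℕ) → (∀ u v → h u v ≡ h v u) → sum (λ u → sum (h u)) ≡
      (∑[ u ∈ Z ] ∑[ v ∈ Z ] h u v + ∑[ u ∈ ∁ Z ] ∑[ v ∈ ∁ Z ] h u v) + 2 * ∑[ u ∈ Z ] ∑[ v ∈ ∁ Z ] h u v
    blocks h h-sym = begin
      sum (λ u → sum (h u))
        ≡⟨ sum-cong-≗ (λ u → sum-split Z (h u)) ⟩
      sum (λ u → ∑∈ Z (h u) + ∑∈ (∁ Z) (h u))
        ≡⟨ sum-split Z _ ⟩
      ∑[ u ∈ Z ] (∑∈ Z (h u) + ∑∈ (∁ Z) (h u)) + ∑[ u ∈ ∁ Z ] (∑∈ Z (h u) + ∑∈ (∁ Z) (h u))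
        ≡⟨ cong₂ _+_ (∑∈-+ Z (∑∈ Z ∘ h) _) (∑∈-+ (∁ Z) (∑∈ Z ∘ h) _) ⟩
      (∑[ u ∈ Z ] ∑∈ Z (h u) + ∑[ u ∈ Z ] ∑∈ (∁ Z) (h u)) + (∑[ u ∈ ∁ Z ] ∑∈ Z (h u) + ∑[ u ∈ ∁ Z ] ∑∈ (∁ Z) (h u))
        ≡⟨ cong (λ t → (∑[ u ∈ Z ] ∑∈ Z (h u) + ∑[ u ∈ Z ] ∑∈ (∁ Z) (h u)) + (t + ∑[ u ∈ ∁ Z ] ∑∈ (∁ Z) (h u)))
             (trans (∑∈-comm (∁ Z) Z h) (∑∈-cong Z λ v _ → ∑∈-cong (∁ Z) λ u _ → h-sym u v)) ⟩
      (∑[ u ∈ Z ] ∑∈ Z (h u) + ∑[ u ∈ Z ] ∑∈ (∁ Z) (h u)) + (∑[ u ∈ Z ] ∑∈ (∁ Z) (h u) + ∑[ u ∈ ∁ Z ] ∑∈ (∁ Z) (h u))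
        ≡⟨ regroup (∑[ u ∈ Z ] ∑∈ Z (h u)) _ _ ⟩
      _ ∎

  -- Product sets of vertices, and extrema over subsets

  ∀-combine : {P : Fin (m * n) → Set} → (∀ j v → P (combine {m} {n} j v)) → ∀ p → P p
  ∀-combine {m} {n} {P} all p = subst P (Fin.combine-remQuot {m} n p) (all (quotient {m} n p) (remainder {m} n p))

  lookup-×ˢ : (P : Subset m) (Q : Subset n) → ∀ j v → lookup (P ×ˢ Q) (combine j v) ≡ lookup P j ∧ lookup Q v
  lookup-×ˢ {m} {n} P Q j v = trans (lookup∘tabulate _ (combine j v))
    (cong (λ (k , w) → lookup P k ∧ lookup Q w) (Fin.remQuot-combine {m} {n} j v))

  ∈-×ˢ⁺ : {P : Subset m} {Q : Subset n} {j : Fin m} {v : Fin n} → j ∈ P → v ∈ Q → combine j v ∈ P ×ˢ Q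
  ∈-×ˢ⁺ {P = P} {Q} {j} {v} j∈P v∈Q = lookup⇒[]= _ _
    (trans (lookup-×ˢ P Q j v) (cong₂ _∧_ ([]=⇒lookup j∈P) ([]=⇒lookup v∈Q)))

  ∈-×ˢ⁻ : {P : Subset m} {Q : Subset n} {j : Fin m} {v : Fin n} → combine j v ∈ P ×ˢ Q → j ∈ P × v ∈ Q
  ∈-×ˢ⁻ {P = P} {Q} {j} {v} jv∈ with lookup P j in j∈ | lookup Q v in v∈ | trans (sym (lookup-×ˢ P Q j v)) ([]=⇒lookup jv∈)
  ... | true | true | _ = lookup⇒[]= j P j∈ , lookup⇒[]= v Q v∈

  ∑∈-×ˢ : (P : Subset m) (Q : Subset n) (f : Fin (m * n) → ℕ) →
          ∑∈ (P ×ˢ Q) f ≡ ∑[ j ∈ P ] ∑[ v ∈ Q ] f (combine j v)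
  ∑∈-×ˢ {m} {n} P Q f = trans (sum-combine {m} {n} _) (sum-cong-≗ λ j → begin
    sum (λ v → ⟦ lookup (P ×ˢ Q) (combine j v) ⟧ * f (combine j v))
      ≡⟨ sum-cong-≗ (λ v → cong (_* f (combine j v)) (trans (cong ⟦_⟧ (lookup-×ˢ P Q j v)) (⟦⟧-∧ (lookup P j) _))) ⟩
    sum (λ v → ⟦ lookup P j ⟧ * ⟦ lookup Q v ⟧ * f (combine j v))
      ≡⟨ sum-cong-≗ {n} (λ v → *-assoc ⟦ lookup P j ⟧ _ _) ⟩
    sum (λ v → ⟦ lookup P j ⟧ * (⟦ lookup Q v ⟧ * f (combine j v)))
      ≡⟨ *-distribˡ-sum {n} ⟦ lookup P j ⟧ _ ⟨
    ⟦ lookup P j ⟧ * ∑[ v ∈ Q ] f (combine j v) ∎)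
    where open ≡-Reasoning

  -- The complement is cut so that the first piece collects the vertices over `∁ Q`, to which the
  -- hypothesis on `Λ̄` will apply, and the second the copies of `Q` in the other layers, where the
  -- argument on rows takes over.
  ∑∈-∁-×ˢ : (P : Subset m) (Q : Subset n) (f : Fin (m * n) → ℕ) →
            ∑∈ (∁ (P ×ˢ Q)) f ≡ ∑[ j ∈ ⊤ {m} ] ∑[ v ∈ ∁ Q ] f (combine j v) + ∑[ j ∈ ∁ P ] ∑[ v ∈ Q ] f (combine j v)
  ∑∈-∁-×ˢ {m} {n} P Q f = trans (trans (sum-cong-≗ {m * n} (∀-combine {m} {n} term)) (∑-distrib-+ {m * n} _ _))
    (cong₂ _+_ (∑∈-×ˢ (⊤ {m}) (∁ Q) f) (∑∈-×ˢ (∁ P) Q f))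
    where
    boolean : ∀ b c → ⟦ not (b ∧ c) ⟧ ≡ ⟦ true ∧ not c ⟧ + ⟦ not b ∧ c ⟧
    boolean true  true  = refl
    boolean true  false = refl
    boolean false true  = refl
    boolean false false = refl

    term : ∀ j v → let p = combine {m} {n} j v in
      ⟦ lookup (∁ (P ×ˢ Q)) p ⟧ * f p ≡ ⟦ lookup (⊤ {m} ×ˢ ∁ Q) p ⟧ * f p + ⟦ lookup (∁ P ×ˢ Q) p ⟧ * f p
    term j v = trans (cong (_* f (combine j v)) (begin
      ⟦ lookup (∁ (P ×ˢ Q)) (combine j v) ⟧
        ≡⟨ cong ⟦_⟧ (trans (lookup-map (combine j v) not (P ×ˢ Q)) (cong not (lookup-×ˢ P Q j v))) ⟩
      ⟦ not (lookup P j ∧ lookup Q v) ⟧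
        ≡⟨ boolean (lookup P j) (lookup Q v) ⟩
      ⟦ true ∧ not (lookup Q v) ⟧ + ⟦ not (lookup P j) ∧ lookup Q v ⟧
        ≡⟨ cong₂ (λ b c → ⟦ b ⟧ + ⟦ c ⟧)
             (trans (lookup-×ˢ (⊤ {m}) (∁ Q) j v) (cong₂ _∧_ (lookup-replicate j true) (lookup-map v not Q)))
             (trans (lookup-×ˢ (∁ P) Q j v) (cong (_∧ lookup Q v) (lookup-map j not P))) ⟨
      ⟦ lookup (⊤ {m} ×ˢ ∁ Q) (combine j v) ⟧ + ⟦ lookup (∁ P ×ˢ Q) (combine j v) ⟧ ∎))
      (*-distribʳ-+ (f (combine j v)) ⟦ lookup (⊤ {m} ×ˢ ∁ Q) (combine j v) ⟧ _)
      where open ≡-Reasoning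

  ∑∈-positive : (X : Subset n) (f : Fin n → ℕ) → 0 < ∑∈ X f → ∃[ u ] (u ∈ X × 0 < f u)
  ∑∈-positive X f 0<Σ with Fin.any? (λ u → (u ∈? X) ×-dec (0 <? f u))
  ... | yes witness = witness
  ... | no  none    = contradiction (begin
    ∑∈ X f          ≡⟨ ∑∈-cong X (λ u u∈X → n≤0⇒n≡0 (≮⇒≥ (λ 0<fu → none (u , u∈X , 0<fu)))) ⟩
    ∑[ _ ∈ X ] 0    ≡⟨ trans (∑∈-const X 0) (*-zeroʳ ∣ X ∣) ⟩
    0               ∎) (≢-sym (<⇒≢ 0<Σ))
    where open ≡-Reasoning

  maximum-on : (X : Subset n) (f : Fin n → ℕ) → ∀ {u} → u ∈ X → ∃[ k ] (k ∈ X × ∀ v → v ∈ X → f v ≤ f k)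
  maximum-on {n} X f {u} u∈X = argmax f u (elements X) ,
    argmax-all f u∈X (all-filter (_∈? X) (allFin n)) ,
    λ v v∈X → All.lookup (f[xs]≤f[argmax] {f = f} u (elements X)) (∈-filter⁺ (_∈? X) (∈-allFin v) v∈X)

  -- Products

  -- Treats both products at once: `ε` is the matrix E for the tensor product and E + I for the
  -- strengthened one.
  module Product {m n : ℕ} (G : Graph n) (X : Subset n) (S : IsSwitchingSet G X) (split : ∀ v → Split G X v)
    (K : Graph (m * n)) (ε : Fin m → Fin m → Bool)
    (adj-K : ∀ j v k w → adj K (combine j v) (combine k w) ≡ ε j k ∧ adj G v w) (i : Fin m) where

    open ≡-Reasoning

    private
      Z : Subset (m * n)
      Z = ⁅ i ⁆ ×ˢ X
      K′ = switch K Z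
      N = ∣ X ∣

    -- An entry of the square of `ε`; a loop, as in E + I, counts as a step.
    walks : Fin m → Fin m → ℕ
    walks j k = sum (λ l → ⟦ ε j l ⟧ * ⟦ ε l k ⟧)

    walks-positive : ∀ {j l k} → ε j l ≡ true → ε l k ≡ true → 0 < walks j k
    walks-positive {j} {l} {k} jl lk = subst₂ _≤_ (cong₂ (λ b c → ⟦ b ⟧ * ⟦ c ⟧) jl lk) (sym (sum≡∑⊤ {m} _))
      (∑∈-≤ ⊤ (λ l → ⟦ ε j l ⟧ * ⟦ ε l k ⟧) l ∈⊤)

    entry-K : ∀ j v k w → entry K (combine j v) (combine k w) ≡ ⟦ ε j k ⟧ * entry G v w
    entry-K j v k w = trans (cong ⟦_⟧ (adj-K j v k w)) (⟦⟧-∧ (ε j k) _)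

    ∑∈-Z : (f : Fin (m * n) → ℕ) → ∑∈ Z f ≡ ∑[ v ∈ X ] f (combine i v)
    ∑∈-Z f = trans (∑∈-×ˢ ⁅ i ⁆ X f) (sum-⁅⁆ i _)

    ∣Z∣≡∣X∣ : ∣ Z ∣ ≡ N
    ∣Z∣≡∣X∣ = begin
      ∣ Z ∣          ≡⟨ *-identityʳ ∣ Z ∣ ⟨
      ∣ Z ∣ * 1      ≡⟨ ∑∈-const Z 1 ⟨
      ∑[ _ ∈ Z ] 1   ≡⟨ ∑∈-Z (λ _ → 1) ⟩
      ∑[ _ ∈ X ] 1   ≡⟨ ∑∈-const X 1 ⟩
      N * 1          ≡⟨ *-identityʳ N ⟩
      N              ∎

    nbrsIn-K : ∀ j v → nbrsIn K Z (combine j v) ≡ ⟦ ε i j ⟧ * nbrsIn G X v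
    nbrsIn-K j v = begin
      nbrsIn K Z (combine j v)                          ≡⟨ nbrsIn≡∑ K Z _ ⟩
      ∑[ p ∈ Z ] entry K p (combine j v)                ≡⟨ ∑∈-Z _ ⟩
      ∑[ u ∈ X ] entry K (combine i u) (combine j v)    ≡⟨ ∑∈-cong X (λ u _ → entry-K i u j v) ⟩
      ∑[ u ∈ X ] (⟦ ε i j ⟧ * entry G u v)              ≡⟨ ∑∈-* X ⟦ ε i j ⟧ _ ⟩
      ⟦ ε i j ⟧ * ∑[ u ∈ X ] entry G u v                ≡⟨ cong (⟦ ε i j ⟧ *_) (nbrsIn≡∑ G X v) ⟨
      ⟦ ε i j ⟧ * nbrsIn G X v                          ∎

    -- The mixed product rule (ε ⊗ A)² = ε² ⊗ A².
    commonNbrs-K : ∀ j v k w → commonNbrs K (combine j v) (combine k w) ≡ walks j k * commonNbrs G v w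
    commonNbrs-K j v k w = begin
      commonNbrs K (combine j v) (combine k w)
        ≡⟨ trans (commonNbrs≡sum K _ _) (sum-combine {m} {n} (λ p → entry K (combine j v) p * entry K p (combine k w))) ⟩
      sum {m} (λ l → sum {n} (λ r → entry K (combine j v) (combine l r) * entry K (combine l r) (combine k w)))
        ≡⟨ sum-cong-≗ (λ l → sum-cong-≗ (λ r → trans (cong₂ _*_ (entry-K j v l r) (entry-K l r k w)) (interchange ⟦ ε j l ⟧ _ _ _))) ⟩
      sum {m} (λ l → sum {n} (λ r → ⟦ ε j l ⟧ * ⟦ ε l k ⟧ * (entry G v r * entry G r w)))
        ≡⟨ sum-cong-≗ {m} (λ l → sym (*-distribˡ-sum {n} (⟦ ε j l ⟧ * ⟦ ε l k ⟧) _)) ⟩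
      sum (λ l → ⟦ ε j l ⟧ * ⟦ ε l k ⟧ * sum (λ r → entry G v r * entry G r w))
        ≡⟨ *-distribʳ-sum {m} _ _ ⟨
      walks j k * sum (λ r → entry G v r * entry G r w)
        ≡⟨ cong (walks j k *_) (commonNbrs≡sum G v w) ⟨
      walks j k * commonNbrs G v w ∎
      where
      interchange : ∀ x y z t → x * y * (z * t) ≡ x * z * (y * t)
      interchange = solve-∀

    degree-K : ∀ j v → degree K (combine j v) ≡ sum (λ l → ⟦ ε j l ⟧) * degree G v
    degree-K j v = begin
      degree K (combine j v)
        ≡⟨ trans (degree≡sum K _) (sum-combine {m} {n} (entry K (combine j v))) ⟩
      sum {m} (λ l → sum {n} (λ r → entry K (combine j v) (combine l r)))
        ≡⟨ sum-cong-≗ (λ l → trans (sum-cong-≗ (λ r → entry-K j v l r)) (sym (*-distribˡ-sum {n} ⟦ ε j l ⟧ _))) ⟩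
      sum (λ l → ⟦ ε j l ⟧ * sum (entry G v))
        ≡⟨ *-distribʳ-sum {m} _ _ ⟨
      sum (λ l → ⟦ ε j l ⟧) * sum (entry G v)
        ≡⟨ cong (sum (λ l → ⟦ ε j l ⟧) *_) (degree≡sum G v) ⟨
      sum (λ l → ⟦ ε j l ⟧) * degree G v ∎

    split-K : ∀ j v → Split K Z (combine j v)
    split-K j v with ε i j | nbrsIn-K j v
    ... | false | eq = inj₁ eq
    ... | true  | eq with trans eq (+-identityʳ _)
    ...   | s≡ = Sum.map (trans s≡) (Sum.map
      (λ 2s≡N → trans (cong (2 *_) s≡) (trans 2s≡N (sym ∣Z∣≡∣X∣)))
      (λ s≡N → trans s≡ (trans s≡N (sym ∣Z∣≡∣X∣)))) (split v)

    ∈-Z⁻ : ∀ j v → combine j v ∈ Z → j ≡ i × v ∈ X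
    ∈-Z⁻ j v p∈Z = let j∈ , v∈X = ∈-×ˢ⁻ {P = ⁅ i ⁆} p∈Z in x∈⁅y⁆⇒x≡y i j∈ , v∈X

    ∈-Z⁺ : ∀ {v} → v ∈ X → combine i v ∈ Z
    ∈-Z⁺ = ∈-×ˢ⁺ (x∈⁅x⁆ i)

    isSwitchingSet : IsSwitchingSet K Z
    isSwitchingSet = record
      { regular = ⟦ ε i i ⟧ * proj₁ regular , ∀-combine λ j v p∈Z → let j≡i , v∈X = ∈-Z⁻ j v p∈Z in
          trans (nbrsIn-K j v) (cong₂ (λ l k → ⟦ ε i l ⟧ * k) j≡i (proj₂ regular v v∈X))
      ; outside = ∀-combine λ j v _ → split-K j v
      }
      where open IsSwitchingSet S

    module _ (u₀∈X : Nonempty X) (d : ℕ) (degree-d : ∀ u → u ∈ X → degree G u ≡ d)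
             (Λ̄-↭ : Λ̄ G X ↭ Λ̄ (switch G X) X)
             (P : Subset n) (nonempty : Nonempty P) (half : ∀ w → w ∈ P → 2 * nbrsIn G X w ≡ N)
             (noncomplementary : NoComplementaryRows G X P) where

      private
        u₀ : Fin n
        u₀ = proj₁ u₀∈X
        G′ = switch G X
        ℓ = commonNbrs G
        instance
          N≢0 : NonZero N
          N≢0 = >-nonZero (∈⇒0<∣∣ G X (proj₂ u₀∈X))

        factor : ∀ e M x y → e * (M * (x + y)) ≡ M * (e * x + e * y)
        factor = solve-∀

      0<∣Z∣ : 0 < ∣ Z ∣
      0<∣Z∣ = ∈⇒0<∣∣ K Z (∈-Z⁺ (proj₂ u₀∈X))

      equidegree-K : ∀ p q → p ∈ Z → q ∈ Z → degree K p ≡ degree K q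
      equidegree-K p q p∈Z q∈Z = trans (degree-Z p p∈Z) (sym (degree-Z q q∈Z))
        where
        degree-Z : ∀ p → p ∈ Z → degree K p ≡ sum (λ l → ⟦ ε i l ⟧) * d
        degree-Z = ∀-combine λ j v p∈Z → let j≡i , v∈X = ∈-Z⁻ j v p∈Z in
          trans (degree-K j v) (cong₂ (λ l e → sum (λ k → ⟦ ε l k ⟧) * e) j≡i (degree-d v v∈X))

      cross-K : ∀ {x k z} → x ∈ X → combine k z ∉ Z →
        N * (commonNbrs K′ (combine i x) (combine k z) + walks i k * ℓ x z) ≡
        walks i k * (2 * ∑[ u ∈ X ] ℓ u z)
      cross-K {x} {k} {z} x∈X kz∉Z = begin
        N * (commonNbrs K′ (combine i x) (combine k z) + walks i k * ℓ x z)
          ≡⟨ cong₂ (λ M t → M * (commonNbrs K′ (combine i x) (combine k z) + t)) ∣Z∣≡∣X∣ (commonNbrs-K i x k z) ⟨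
        ∣ Z ∣ * (commonNbrs K′ (combine i x) (combine k z) + commonNbrs K (combine i x) (combine k z))
          ≡⟨ commonNbrs-cross K Z isSwitchingSet (∈-Z⁺ x∈X) kz∉Z ⟩
        2 * ∑[ p ∈ Z ] commonNbrs K p (combine k z)
          ≡⟨ cong (2 *_) (trans (∑∈-Z _) (trans (∑∈-cong X (λ u _ → commonNbrs-K i u k z)) (∑∈-* X (walks i k) _))) ⟩
        2 * (walks i k * ∑[ u ∈ X ] ℓ u z)
          ≡⟨ x*yz≈y*xz 2 (walks i k) _ ⟩
        walks i k * (2 * ∑[ u ∈ X ] ℓ u z) ∎

      -- Scaling by `walks i k` commutes with reflection in the mean, and over a vertex outside `X`
      -- that reflection is what switching does in `G` itself.
      commonNbrs-K′-outside : ∀ {x} k {z} → x ∈ X → z ∉ X →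
        commonNbrs K′ (combine i x) (combine k z) ≡ walks i k * commonNbrs G′ x z
      commonNbrs-K′-outside {x} k {z} x∈X z∉X = +-cancelʳ-≡ (walks i k * ℓ x z) _ _ (*-cancelˡ-≡ _ _ N (begin
        N * (commonNbrs K′ (combine i x) (combine k z) + walks i k * ℓ x z)
          ≡⟨ cross-K x∈X (λ kz∈Z → z∉X (proj₂ (∈-Z⁻ k z kz∈Z))) ⟩
        walks i k * (2 * ∑[ u ∈ X ] ℓ u z)
          ≡⟨ cong (walks i k *_) (commonNbrs-cross G X S x∈X z∉X) ⟨
        walks i k * (N * (commonNbrs G′ x z + ℓ x z))
          ≡⟨ factor (walks i k) N _ _ ⟩
        N * (walks i k * commonNbrs G′ x z + walks i k * ℓ x z) ∎))

      -- The reflected value is e (d + J - λ(x , z)), and J < λ(x , z) by `isFull<commonNbrs`. The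
      -- gap is stated as e, not as 1, because e may be 0 for some layers.
      commonNbrs-K′-inside : ∀ {x k z} → k ≢ i → x ∈ X → z ∈ X →
        commonNbrs K′ (combine i x) (combine k z) + walks i k ≤ walks i k * d
      commonNbrs-K′-inside {x} {k} {z} k≢i x∈X z∈X = +-cancelʳ-≤ (e * J) _ _ (≤-trans
        (≤-reflexive (regroup λ′ e J))
        (≤-trans (+-monoʳ-≤ λ′ (*-monoʳ-≤ e (isFull<commonNbrs G X split d degree-d P nonempty half noncomplementary x∈X z∈X)))
        (≤-reflexive (*-cancelˡ-≡ _ _ N (begin
          N * (λ′ + e * ℓ x z)           ≡⟨ cross-K x∈X (λ kz∈Z → k≢i (proj₁ (∈-Z⁻ k z kz∈Z))) ⟩
          e * (2 * ∑[ u ∈ X ] ℓ u z)     ≡⟨ cong (e *_) (∑-commonNbrs-inside G X split d degree-d z∈X) ⟩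
          e * (N * (d + J))              ≡⟨ factor e N d J ⟩
          N * (e * d + e * J)            ∎)))))
        where
        e J λ′ : ℕ
        e = walks i k
        J = ∑∈ ⊤ (isFull G X)
        λ′ = commonNbrs K′ (combine i x) (combine k z)
        regroup : ∀ x e j → x + e + e * j ≡ x + e * suc j
        regroup = solve-∀

      commonNbrs-self : ∀ {u} → u ∈ X → ℓ u u ≡ d
      commonNbrs-self {u} u∈X = begin
        ℓ u u                                     ≡⟨ commonNbrs≡sum G u u ⟩
        sum (λ r → entry G u r * entry G r u)     ≡⟨ sum-cong-≗ (λ r → trans (cong (entry G u r *_) (entry-sym G r u)) (square (adj G u r))) ⟩
        sum (entry G u)                           ≡⟨ degree≡sum G u ⟨
        degree G u                                ≡⟨ degree-d u u∈X ⟩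
        d                                         ∎
        where
        square : ∀ b → ⟦ b ⟧ * ⟦ b ⟧ ≡ ⟦ b ⟧
        square true  = refl
        square false = refl

      -- The diagonal case of `isFull<commonNbrs`. It makes the value T below positive, which rules
      -- out layers with no walk of length two from `i`.
      0<d : 0 < d
      0<d = ≤-<-trans z≤n (subst (∑∈ ⊤ (isFull G X) <_) (commonNbrs-self (proj₂ u₀∈X))
        (isFull<commonNbrs G X split d degree-d P nonempty half noncomplementary (proj₂ u₀∈X) (proj₂ u₀∈X)))

      -- With T the largest value e d of the common neighbour counts between
      -- {i} × X and (V(H) ∖ i) × X, no such pair of the switched graph attains T,
      -- while all the other pairs contribute T equally often before and after.
      switch-≇ : ∀ {k} → k ≢ i → 0 < walks i k → ¬ (K ≅ K′)
      switch-≇ {k₁} k₁≢i 0<walks iso = contradiction ∑≡0 (≢-sym (<⇒≢ 0<∑))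
        where
        max : ∃[ k ] (k ∈ ∁ ⁅ i ⁆ × ∀ l → l ∈ ∁ ⁅ i ⁆ → walks i l ≤ walks i k)
        max = maximum-on (∁ ⁅ i ⁆) (walks i) (x∉p⇒x∈∁p (λ k₁∈ → k₁≢i (x∈⁅y⁆⇒x≡y i k₁∈)))

        k₀ : Fin m
        k₀ = proj₁ max

        0<e : 0 < walks i k₀
        0<e = <-≤-trans 0<walks (proj₂ (proj₂ max) k₁ (x∉p⇒x∈∁p (λ k₁∈ → k₁≢i (x∈⁅y⁆⇒x≡y i k₁∈))))

        T : ℕ
        T = walks i k₀ * d

        hit : ℕ → ℕ
        hit t = ⟦ ⌊ t ≟ T ⌋ ⟧

        hit-yes : ∀ {t} → t ≡ T → hit t ≡ 1
        hit-yes {t} t≡T with t ≟ T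
        ... | yes _   = refl
        ... | no t≢T  = contradiction t≡T t≢T

        hit-no : ∀ {t} → t ≢ T → hit t ≡ 0
        hit-no {t} t≢T with t ≟ T
        ... | yes t≡T = contradiction t≡T t≢T
        ... | no _    = refl

        cross : (Fin (m * n) → Fin (m * n) → ℕ) → ℕ
        cross λ″ = ∑[ p ∈ Z ] ∑[ q ∈ ∁ Z ] hit (λ″ p q)

        near far : (Fin (m * n) → Fin (m * n) → ℕ) → ℕ
        near λ″ = ∑[ k ∈ ⊤ {m} ] ∑[ x ∈ X ] ∑[ z ∈ ∁ X ] hit (λ″ (combine i x) (combine k z))
        far  λ″ = ∑[ x ∈ X ] ∑[ k ∈ ∁ ⁅ i ⁆ ] ∑[ z ∈ X ] hit (λ″ (combine i x) (combine k z))

        cross≡ : ∀ λ″ → cross λ″ ≡ near λ″ + far λ″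
        cross≡ λ″ = begin
          cross λ″
            ≡⟨ ∑∈-Z _ ⟩
          ∑[ x ∈ X ] ∑[ q ∈ ∁ Z ] hit (λ″ (combine i x) q)
            ≡⟨ ∑∈-cong X (λ x _ → ∑∈-∁-×ˢ ⁅ i ⁆ X _) ⟩
          ∑[ x ∈ X ] (∑[ k ∈ ⊤ {m} ] ∑[ z ∈ ∁ X ] hit (λ″ (combine i x) (combine k z)) +
                      ∑[ k ∈ ∁ ⁅ i ⁆ ] ∑[ z ∈ X ] hit (λ″ (combine i x) (combine k z)))
            ≡⟨ ∑∈-+ X (λ x → ∑[ k ∈ ⊤ {m} ] ∑[ z ∈ ∁ X ] hit (λ″ (combine i x) (combine k z))) _ ⟩
          ∑[ x ∈ X ] ∑[ k ∈ ⊤ {m} ] ∑[ z ∈ ∁ X ] hit (λ″ (combine i x) (combine k z)) + far λ″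
            ≡⟨ cong (_+ far λ″) (∑∈-comm X (⊤ {m}) _) ⟩
          near λ″ + far λ″ ∎

        near≡ : near (commonNbrs K) ≡ near (commonNbrs K′)
        near≡ = ∑∈-cong (⊤ {m}) λ k _ → begin
          ∑[ x ∈ X ] ∑[ z ∈ ∁ X ] hit (commonNbrs K (combine i x) (combine k z))
            ≡⟨ ∑∈-cong X (λ x _ → ∑∈-cong (∁ X) (λ z _ → cong hit (commonNbrs-K i x k z))) ⟩
          ∑[ x ∈ X ] ∑[ z ∈ ∁ X ] hit (walks i k * ℓ x z)
            -- Within one layer the factor `walks i k` is constant, so it can be absorbed into the
            -- test function that is summed over `Λ̄`.
            ≡⟨ ∑-Λ̄ G X (λ t → hit (walks i k * t)) ⟨
          sumˡ (map (λ t → hit (walks i k * t)) (Λ̄ G X))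
            ≡⟨ sum-↭ (↭.map⁺ (λ t → hit (walks i k * t)) Λ̄-↭) ⟩
          sumˡ (map (λ t → hit (walks i k * t)) (Λ̄ G′ X))
            ≡⟨ ∑-Λ̄ G′ X (λ t → hit (walks i k * t)) ⟩
          ∑[ x ∈ X ] ∑[ z ∈ ∁ X ] hit (walks i k * commonNbrs G′ x z)
            ≡⟨ ∑∈-cong X (λ x x∈X → ∑∈-cong (∁ X) (λ z z∈∁X → cong hit (sym (commonNbrs-K′-outside k x∈X (x∈∁p⇒x∉p z∈∁X))))) ⟩
          ∑[ x ∈ X ] ∑[ z ∈ ∁ X ] hit (commonNbrs K′ (combine i x) (combine k z)) ∎

        cross-≅ : cross (commonNbrs K) ≡ cross (commonNbrs K′)
        cross-≅ = cross-sum Z (λ p q → hit (commonNbrs K p q)) (λ p q → hit (commonNbrs K′ p q))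
          (λ p q → cong hit (commonNbrs-sym K p q)) (λ p q → cong hit (commonNbrs-sym K′ p q))
          (λ p q p∈Z q∈Z → cong hit (sym (commonNbrs-inside K Z isSwitchingSet equidegree-K p∈Z q∈Z)))
          (λ p q p∈∁Z q∈∁Z → cong hit (sym (commonNbrs-outside K Z isSwitchingSet 0<∣Z∣ (x∈∁p⇒x∉p p∈∁Z) (x∈∁p⇒x∉p q∈∁Z))))
          (∑-commonNbrs-≅ {G = K} {K′} iso hit)

        -- If T were attained in layer `k`, then T + e ≤ e d ≤ T by maximality, so e = 0. The bound
        -- then reads T ≤ 0, although both factors of T are positive.
        below-T : ∀ {x k z} → k ≢ i → x ∈ X → z ∈ X → commonNbrs K′ (combine i x) (combine k z) ≢ T
        below-T {x} {k} {z} k≢i x∈X z∈X λ′≡T = contradiction T≡0 (≢-sym (<⇒≢ (*-mono-≤ 0<e 0<d)))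
          where
          e : ℕ
          e = walks i k

          T+e≤ed : T + e ≤ e * d
          T+e≤ed = subst (λ t → t + e ≤ e * d) λ′≡T (commonNbrs-K′-inside k≢i x∈X z∈X)

          ed≤T : e * d ≤ T
          ed≤T = *-monoˡ-≤ d (proj₂ (proj₂ max) k (x∉p⇒x∈∁p (λ k∈ → k≢i (x∈⁅y⁆⇒x≡y i k∈))))

          e≡0 : e ≡ 0
          e≡0 = n≤0⇒n≡0 (+-cancelˡ-≤ T _ _ (≤-trans T+e≤ed (≤-trans ed≤T (≤-reflexive (sym (+-identityʳ T))))))

          T≡0 : T ≡ 0
          T≡0 = n≤0⇒n≡0 (≤-trans (m≤m+n T e) (subst (λ t → T + e ≤ t * d) e≡0 T+e≤ed))

        far-K′ : far (commonNbrs K′) ≡ 0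
        far-K′ = begin
          far (commonNbrs K′)
            ≡⟨ ∑∈-cong X (λ x x∈X → ∑∈-cong (∁ ⁅ i ⁆) (λ k k∈ → ∑∈-cong X (λ z z∈X →
                 hit-no (below-T (λ k≡i → x∈∁p⇒x∉p k∈ (subst (_∈ ⁅ i ⁆) (sym k≡i) (x∈⁅x⁆ i))) x∈X z∈X)))) ⟩
          ∑[ _ ∈ X ] ∑[ _ ∈ ∁ ⁅ i ⁆ ] ∑[ _ ∈ X ] 0
            ≡⟨ ∑∈-cong X (λ _ _ → ∑∈-cong (∁ ⁅ i ⁆) (λ _ _ → vanish X)) ⟩
          ∑[ _ ∈ X ] ∑[ _ ∈ ∁ ⁅ i ⁆ ] 0
            ≡⟨ ∑∈-cong X (λ _ _ → vanish (∁ ⁅ i ⁆)) ⟩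
          ∑[ _ ∈ X ] 0
            ≡⟨ vanish X ⟩
          0 ∎
          where
          vanish : ∀ {k} (Y : Subset k) → ∑[ _ ∈ Y ] 0 ≡ 0
          vanish Y = trans (∑∈-const Y 0) (*-zeroʳ ∣ Y ∣)

        ∑≡0 : far (commonNbrs K) ≡ 0
        ∑≡0 = trans (+-cancelˡ-≡ (near (commonNbrs K)) _ _ (begin
          near (commonNbrs K) + far (commonNbrs K)    ≡⟨ cross≡ (commonNbrs K) ⟨
          cross (commonNbrs K)                        ≡⟨ cross-≅ ⟩
          cross (commonNbrs K′)                       ≡⟨ cross≡ (commonNbrs K′) ⟩
          near (commonNbrs K′) + far (commonNbrs K′)  ≡⟨ cong (_+ far (commonNbrs K′)) near≡ ⟨
          near (commonNbrs K) + far (commonNbrs K′)   ∎)) far-K′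

        -- The witness is a pair of copies of the same vertex `u₀`, in layers `i` and `k₀`: a row of
        -- `G` meets itself in d columns.
        0<∑ : 0 < far (commonNbrs K)
        0<∑ = subst (_≤ far (commonNbrs K))
          (hit-yes (trans (commonNbrs-K i u₀ k₀ u₀) (cong (walks i k₀ *_) (commonNbrs-self (proj₂ u₀∈X)))))
          (≤-trans (∑∈-≤ X (λ z → hit (commonNbrs K (combine i u₀) (combine k₀ z))) u₀ (proj₂ u₀∈X))
          (≤-trans (∑∈-≤ (∁ ⁅ i ⁆) (λ k → ∑[ z ∈ X ] hit (commonNbrs K (combine i u₀) (combine k z))) k₀ (proj₁ (proj₂ max)))
                   (∑∈-≤ X (λ x → ∑[ k ∈ ∁ ⁅ i ⁆ ] ∑[ z ∈ X ] hit (commonNbrs K (combine i x) (combine k z))) u₀ (proj₂ u₀∈X))))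

  -- Adjacency in the two products, and neighbours in H

  adj-×ᵍ : (H : Graph m) (G : Graph n) → ∀ j v k w →
           adj (H ×ᵍ G) (combine j v) (combine k w) ≡ adj H j k ∧ adj G v w
  adj-×ᵍ {m} {n} H G j v k w =
    cong₂ (λ (j , v) (k , w) → adj H j k ∧ adj G v w) (Fin.remQuot-combine {m} {n} j v) (Fin.remQuot-combine {m} {n} k w)

  adj-⊠ : (H : Graph m) (G : Graph n) → ∀ j v k w →
          adj (H ⊠ G) (combine j v) (combine k w) ≡ adjOrEq H j k ∧ adj G v w
  adj-⊠ {m} {n} H G j v k w =
    cong₂ (λ (j , v) (k , w) → adjOrEq H j k ∧ adj G v w) (Fin.remQuot-combine {m} {n} j v) (Fin.remQuot-combine {m} {n} k w)

  adj⇒≢ : (H : Graph m) → ∀ {j k} → adj H j k ≡ true → j ≢ k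
  adj⇒≢ H {j} jk refl with trans (sym jk) (adj-irrefl H j)
  ... | ()

  positive-⟦⟧ : ∀ {b} → 0 < ⟦ b ⟧ → b ≡ true
  positive-⟦⟧ {true} _ = refl

  neighbour : (H : Graph m) → ∀ {j} → 1 ≤ degree H j → ∃[ k ] adj H j k ≡ true
  neighbour H {j} 1≤deg = let k , _ , 0<jk = ∑∈-positive ⊤ (entry H j) (subst (1 ≤_) (trans (degree≡sum H j) (sum≡∑⊤ (entry H j))) 1≤deg)
                          in k , positive-⟦⟧ 0<jk

  other-neighbour : (H : Graph m) → ∀ {j} i → 2 ≤ degree H j → ∃[ k ] (k ≢ i × adj H j k ≡ true)
  other-neighbour H {j} i 2≤deg =
    let k , k∈ , 0<jk = ∑∈-positive (∁ ⁅ i ⁆) (entry H j) (+-cancelˡ-≤ 1 _ _ (≤-trans 2≤deg (≤-trans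
          (≤-reflexive (trans (degree≡sum H j) (sum-split ⁅ i ⁆ (entry H j))))
          (+-monoˡ-≤ _ (≤-trans (≤-reflexive (sum-⁅⁆ i (entry H j))) (entry≤1 H j i))))))
    in k , (λ k≡i → x∈∁p⇒x∉p k∈ (subst (_∈ ⁅ i ⁆) (sym k≡i) (x∈⁅x⁆ i))) , positive-⟦⟧ 0<jk

  -- Cases (a) and (b) as one condition

  ∈-halfSet⁻ : (G : Graph n) (X : Subset n) → ∀ {v} → v ∈ halfSet G X → 2 * nbrsIn G X v ≡ ∣ X ∣
  ∈-halfSet⁻ G X {v} v∈ with trans (sym (lookup-halfSet G X v)) ([]=⇒lookup v∈)
  ... | eq with lookup X v | 2 * nbrsIn G X v ≟ ∣ X ∣
  ...   | false | yes 2s≡N = 2s≡N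

  -- `P` is the set of half columns on which rows are compared: those of N in case (a), those of
  -- [B N] in case (b), where the vertices of `X` are half columns themselves.
  record Admissible (G : Graph n) (X : Subset n) : Set where
    field
      split            : ∀ v → Split G X v
      P                : Subset n
      nonempty         : Nonempty P
      half             : ∀ w → w ∈ P → 2 * nbrsIn G X w ≡ ∣ X ∣
      noncomplementary : NoComplementaryRows G X P

  coclique-admissible : (G : Graph n) (X : Subset n) → IsSwitchingSet G X →
    (∀ u v → u ∈ X → v ∈ X → adj G u v ≡ false) → 2 ≤ ∣ halfSet G X ∣ →
    NoComplementaryRows G X (halfSet G X) → Admissible G X
  coclique-admissible G X S coclique 2≤∣half∣ noncomp = record
    { split            = λ v → split v
    ; P                = halfSet G X
    ; nonempty         = let w , w∈ , _ = ∑∈-positive (halfSet G X) (λ _ → 1)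
                               (subst (0 <_) (sym (trans (∑∈-const (halfSet G X) 1) (*-identityʳ _))) (<-trans (s≤s z≤n) 2≤∣half∣))
                         in w , w∈
    ; half             = λ w → ∈-halfSet⁻ G X
    ; noncomplementary = noncomp
    }
    where
    split : ∀ v → Split G X v
    split v with v ∈? X
    ... | no  v∉X = IsSwitchingSet.outside S v v∉X
    ... | yes v∈X = inj₁ (trans (nbrsIn≡∑ G X v) (trans
      (∑∈-cong X (λ u u∈X → cong ⟦_⟧ (coclique u v u∈X v∈X))) (trans (∑∈-const X 0) (*-zeroʳ ∣ X ∣))))

  half-regular-admissible : (G : Graph n) (X : Subset n) → Nonempty X → IsSwitchingSet G X →
    (∀ u → u ∈ X → 2 * nbrsIn G X u ≡ ∣ X ∣) → NoComplementaryRows G X (X ∪ halfSet G X) → Admissible G X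
  half-regular-admissible G X (u , u∈X) S half-regular noncomp = record
    { split            = split
    ; P                = X ∪ halfSet G X
    ; nonempty         = u , x∈p∪q⁺ (inj₁ u∈X)
    ; half             = λ w w∈ → Sum.[ half-regular w , ∈-halfSet⁻ G X ] (x∈p∪q⁻ X (halfSet G X) w∈)
    ; noncomplementary = noncomp
    }
    where
    split : ∀ v → Split G X v
    split v with v ∈? X
    ... | no  v∉X = IsSwitchingSet.outside S v v∉X
    ... | yes v∈X = inj₂ (inj₁ (half-regular v v∈X))

-- Cospectrality over Heyting fields of characteristic zero

module Spectra where

  open CommonNeighbours
  import Algebra.Properties.Ring as RingProperties
  import Algebra.Properties.Semiring.Mult as SemiringMult
  import Algebra.Properties.Semiring.Sum as SemiringSum
  import Data.Nat.Base as ℕ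
  import Data.Nat.Properties as ℕ
  import Relation.Binary.PropositionalEquality as ≡
  open SemiringSum ℕ.+-*-semiring using () renaming (sum to sumℕ)

  module _ {c ℓ₁ ℓ₂ : Level} (F : HeytingField c ℓ₁ ℓ₂) where
    open HeytingField F using (heytingCommutativeRing; #⇒invertible)
    open CommutativeRing (HeytingCommutativeRing.commutativeRing heytingCommutativeRing)
      hiding (zero) renaming (_*_ to _·_)
    open SemiringSum semiring using (sum; sum-cong-≋; ∑-distrib-+; ∑-comm; *-distribˡ-sum; *-distribʳ-sum)
    open SemiringMult semiring using (×-homo-+; ×1-homo-*) renaming (_×_ to _⋆_)
    open RingProperties ring using (-0#≈0#; -1*x≈-x; -‿involutive)
    open CommutativeSemigroupProperties *-commutativeSemigroup using () renaming (x∙yz≈y∙xz to x·yz≈y·xz)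
    open Spectrum F
    open import Relation.Binary.Reasoning.Setoid setoid

    private
      ι : ℕ → Carrier
      ι k = k ⋆ 1#

      ι-+ : ∀ k l → ι (k ℕ.+ l) ≈ ι k + ι l
      ι-+ = ×-homo-+ 1#

      ι-sum : (f : Fin n → ℕ) → ι (sumℕ f) ≈ sum (ι ∘ f)
      ι-sum {zero}  f = refl
      ι-sum {suc n} f = trans (ι-+ (f zero) _) (+-congˡ (ι-sum (f ∘ suc)))

      ι-⟦⟧ : ∀ b → ι ⟦ b ⟧ ≈ (if b then 1# else 0#)
      ι-⟦⟧ true  = +-identityʳ 1#
      ι-⟦⟧ false = refl

    apply : Graph n → Vector Carrier n → Vector Carrier n
    apply G x u = sum (λ v → adjMatrix G u v · x v)

    -- An involution carries a basis of one eigenspace to a basis of the other.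
    module _ (G G′ : Graph n) (Q : Vector Carrier n → Vector Carrier n)
             (Q-cong : ∀ {x y} → (∀ u → x u ≈ y u) → ∀ u → Q x u ≈ Q y u)
             (Q-combination : ∀ {m} (a : Vector Carrier m) b u → Q (combination a b) u ≈ combination a (Q ∘ b) u)
             (Q-zero : ∀ u → Q (λ _ → 0#) u ≈ 0#)
             (Q-involutive : ∀ x u → Q (Q x) u ≈ x u)
             (θ : Carrier)
             (Q-eigen : ∀ x → InEigenspace G θ x → InEigenspace G′ θ (Q x))
             (Q-eigen⁻¹ : ∀ x → InEigenspace G′ θ x → InEigenspace G θ (Q x)) where

      transport : ∀ {k} → HasMultiplicity G θ k → HasMultiplicity G′ θ k
      transport M = record
        { basis       = Q ∘ basis
        ; eigen       = λ j → Q-eigen (basis j) (eigen j)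
        ; independent = λ a vanishes → independent a λ u → begin
            combination a basis u           ≈⟨ Q-involutive (combination a basis) u ⟨
            Q (Q (combination a basis)) u   ≈⟨ Q-cong (λ v → trans (Q-combination a basis v) (vanishes v)) u ⟩
            Q (λ _ → 0#) u                  ≈⟨ Q-zero u ⟩
            0#                              ∎
        ; spanning    = λ x x∈E → let a , eq = spanning (Q x) (Q-eigen⁻¹ x x∈E) in a , λ u → begin
            x u                             ≈⟨ Q-involutive x u ⟨
            Q (Q x) u                       ≈⟨ Q-cong eq u ⟩
            Q (combination a basis) u       ≈⟨ Q-combination a basis u ⟩
            combination a (Q ∘ basis) u     ∎
        }
        where open HasMultiplicity M

    -- `h` is the inverse of |X|; with it as a parameter, the field's inverses are used in
    -- `invertible` alone.
    module _ (G : Graph n) (X : Subset n) (h : Carrier) (hN≈1 : h · ι ∣ X ∣ ≈ 1#)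
             (0<N : 0 < ∣ X ∣) (S : IsSwitchingSet G X) where

      private
        G′ = switch G X
        N = ∣ X ∣
        s = nbrsIn G X

        χ ε : Vector Carrier n
        χ u = if lookup X u then 1# else 0#
        ε u = if lookup X u then - 1# else 1#

        τ : Carrier
        τ = h + h

        σ : Vector Carrier n → Carrier
        σ x = sum (λ w → χ w · x w)

        -- The block matrix diag(2J/|X| - I, I).
        Q : Vector Carrier n → Vector Carrier n
        Q x u = χ u · (τ · σ x) + ε u · x u

        σ-cong : ∀ {x y} → (∀ u → x u ≈ y u) → σ x ≈ σ y
        σ-cong x≈y = sum-cong-≋ (λ w → *-congˡ (x≈y w))

        Q-cong : ∀ {x y} → (∀ u → x u ≈ y u) → ∀ u → Q x u ≈ Q y u
        Q-cong x≈y u = +-cong (*-congˡ (*-congˡ (σ-cong x≈y))) (*-congˡ (x≈y u))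

        σ-combination : (a : Vector Carrier m) (b : Vector (Vector Carrier n) m) →
                        σ (combination a b) ≈ sum (λ k → a k · σ (b k))
        σ-combination {m} a b = begin
          sum (λ w → χ w · sum (λ k → a k · b k w))
            ≈⟨ sum-cong-≋ (λ w → *-distribˡ-sum {m} (χ w) _) ⟩
          sum (λ w → sum (λ k → χ w · (a k · b k w)))
            ≈⟨ ∑-comm {n} {m} _ ⟩
          sum (λ k → sum (λ w → χ w · (a k · b k w)))
            ≈⟨ sum-cong-≋ (λ k → trans (sum-cong-≋ {n} (λ w → x·yz≈y·xz (χ w) (a k) (b k w))) (sym (*-distribˡ-sum {n} (a k) _))) ⟩
          sum (λ k → a k · σ (b k)) ∎

        Q-combination : (a : Vector Carrier m) (b : Vector (Vector Carrier n) m) →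
                        ∀ u → Q (combination a b) u ≈ combination a (Q ∘ b) u
        Q-combination {m} a b u = begin
          χ u · (τ · σ (combination a b)) + ε u · combination a b u
            ≈⟨ +-cong (trans (sym (*-assoc (χ u) τ _)) (*-congˡ (σ-combination a b))) refl ⟩
          χ u · τ · sum (λ k → a k · σ (b k)) + ε u · combination a b u
            ≈⟨ +-cong (*-distribˡ-sum {m} _ _) (*-distribˡ-sum {m} _ _) ⟩
          sum (λ k → χ u · τ · (a k · σ (b k))) + sum (λ k → ε u · (a k · b k u))
            ≈⟨ ∑-distrib-+ {m} _ _ ⟨
          sum (λ k → χ u · τ · (a k · σ (b k)) + ε u · (a k · b k u))
            ≈⟨ sum-cong-≋ {m} (λ k → trans (+-cong (trans (x·yz≈y·xz _ (a k) _) (*-congˡ (*-assoc (χ u) τ _))) (x·yz≈y·xz (ε u) (a k) _)) (sym (distribˡ (a k) _ _))) ⟩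
          combination a (Q ∘ b) u ∎

        Q-scale : ∀ θ x u → Q (λ v → θ · x v) u ≈ θ · Q x u
        Q-scale θ x u = begin
          χ u · (τ · σ (λ v → θ · x v)) + ε u · (θ · x u)
            ≈⟨ +-cong (*-congˡ (*-congˡ (trans (sum-cong-≋ {n} (λ w → x·yz≈y·xz (χ w) θ (x w))) (sym (*-distribˡ-sum {n} θ _))))) (x·yz≈y·xz (ε u) θ (x u)) ⟩
          χ u · (τ · (θ · σ x)) + θ · (ε u · x u)
            ≈⟨ +-congʳ (trans (*-congˡ (x·yz≈y·xz τ θ _)) (x·yz≈y·xz (χ u) θ _)) ⟩
          θ · (χ u · (τ · σ x)) + θ · (ε u · x u)
            ≈⟨ distribˡ θ _ _ ⟨
          θ · Q x u ∎

        Q-zero : ∀ u → Q (λ _ → 0#) u ≈ 0#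
        Q-zero u = trans (Q-cong {λ _ → 0#} {λ _ → 0# · 0#} (λ _ → sym (zeroˡ 0#)) u)
          (trans (Q-scale 0# (λ _ → 0#) u) (zeroˡ _))

        sum-χ : sum χ ≈ ι N
        sum-χ = trans (sum-cong-≋ (λ w → sym (ι-⟦⟧ (lookup X w))))
          (trans (sym (ι-sum (λ w → ⟦ lookup X w ⟧))) (reflexive (≡.cong ι (≡.sym (∣∣≡sum X)))))

        x+y-y : ∀ x y → (x + y) + - 1# · y ≈ x
        x+y-y x y = begin
          (x + y) + - 1# · y ≈⟨ +-congˡ (-1*x≈-x y) ⟩
          (x + y) + - y      ≈⟨ +-assoc x y (- y) ⟩
          x + (y + - y)      ≈⟨ +-congˡ (-‿inverseʳ y) ⟩
          x + 0#             ≈⟨ +-identityʳ x ⟩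
          x                  ∎

        Nτ : ι N · τ ≈ 1# + 1#
        Nτ = trans (distribˡ (ι N) h h) (+-cong Nh Nh)
          where Nh = trans (*-comm (ι N) h) hN≈1

        χ-Q : ∀ x w → χ w · Q x w ≈ χ w · (τ · σ x) + - 1# · (χ w · x w)
        χ-Q x w with lookup X w
        ... | true  = begin
          1# · (1# · (τ · σ x) + - 1# · x w) ≈⟨ *-identityˡ _ ⟩
          1# · (τ · σ x) + - 1# · x w        ≈⟨ +-congˡ (*-congˡ (sym (*-identityˡ (x w)))) ⟩
          1# · (τ · σ x) + - 1# · (1# · x w) ∎
        ... | false = begin
          0# · (0# · (τ · σ x) + 1# · x w)   ≈⟨ zeroˡ _ ⟩
          0#                                 ≈⟨ zeroʳ (- 1#) ⟨
          - 1# · 0#                          ≈⟨ *-congˡ (zeroˡ (x w)) ⟨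
          - 1# · (0# · x w)                  ≈⟨ +-identityˡ _ ⟨
          0# + - 1# · (0# · x w)             ≈⟨ +-congʳ (zeroˡ (τ · σ x)) ⟨
          0# · (τ · σ x) + - 1# · (0# · x w) ∎

        -- Again a reflection preserves the sum: the factor is |X| (2 / |X|) - 1 = 1. Involutivity
        -- of `Q` rests on this.
        σ-Q : ∀ x → σ (Q x) ≈ σ x
        σ-Q x = begin
          σ (Q x)                                                 ≈⟨ sum-cong-≋ (χ-Q x) ⟩
          sum (λ w → χ w · (τ · σ x) + - 1# · (χ w · x w))         ≈⟨ ∑-distrib-+ {n} _ _ ⟩
          sum (λ w → χ w · (τ · σ x)) + sum (λ w → - 1# · (χ w · x w)) ≈⟨ +-cong (*-distribʳ-sum (τ · σ x) χ) (*-distribˡ-sum {n} (- 1#) _) ⟨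
          sum χ · (τ · σ x) + - 1# · σ x                          ≈⟨ +-congʳ (trans (*-congʳ sum-χ) (sym (*-assoc (ι N) τ (σ x)))) ⟩
          ι N · τ · σ x + - 1# · σ x                              ≈⟨ +-congʳ (*-congʳ Nτ) ⟩
          (1# + 1#) · σ x + - 1# · σ x                            ≈⟨ +-congʳ (trans (distribʳ (σ x) 1# 1#) (+-cong (*-identityˡ _) (*-identityˡ _))) ⟩
          (σ x + σ x) + - 1# · σ x                                ≈⟨ x+y-y (σ x) (σ x) ⟩
          σ x                                                     ∎

        Q-involutive : ∀ x u → Q (Q x) u ≈ x u
        Q-involutive x u = trans (+-congʳ (*-congˡ (*-congˡ (σ-Q x)))) local
          where
          local : χ u · (τ · σ x) + ε u · Q x u ≈ x u
          local with lookup X u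
          ... | true  = begin
            1# · (τ · σ x) + - 1# · (1# · (τ · σ x) + - 1# · x u)
              ≈⟨ +-congˡ (trans (distribˡ (- 1#) _ _) (+-comm _ _)) ⟩
            1# · (τ · σ x) + (- 1# · (- 1# · x u) + - 1# · (1# · (τ · σ x)))
              ≈⟨ trans (sym (+-assoc _ _ _)) (+-congʳ (+-comm _ _)) ⟩
            (- 1# · (- 1# · x u) + 1# · (τ · σ x)) + - 1# · (1# · (τ · σ x))
              ≈⟨ x+y-y _ _ ⟩
            - 1# · (- 1# · x u)
              ≈⟨ trans (-1*x≈-x _) (trans (-‿cong (-1*x≈-x (x u))) (-‿involutive (x u))) ⟩
            x u ∎
          ... | false = begin
            0# · (τ · σ x) + 1# · (0# · (τ · σ x) + 1# · x u)
              ≈⟨ +-cong (zeroˡ _) (*-identityˡ _) ⟩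
            0# + (0# · (τ · σ x) + 1# · x u)
              ≈⟨ trans (+-identityˡ _) (+-cong (zeroˡ _) (*-identityˡ _)) ⟩
            0# + x u
              ≈⟨ +-identityˡ (x u) ⟩
            x u ∎

        -- The point where the counting relation over ℕ is divided by |X| and becomes an equation in
        -- the field.
        adj-cross : ∀ {a a′} t → N ℕ.* (⟦ a′ ⟧ ℕ.+ ⟦ a ⟧) ≡ 2 ℕ.* t →
                    (if a′ then 1# else 0#) + (if a then 1# else 0#) ≈ τ · ι t
        adj-cross {a} {a′} t eq = begin
          (if a′ then 1# else 0#) + (if a then 1# else 0#) ≈⟨ +-cong (ι-⟦⟧ a′) (ι-⟦⟧ a) ⟨
          ι ⟦ a′ ⟧ + ι ⟦ a ⟧                  ≈⟨ ι-+ ⟦ a′ ⟧ ⟦ a ⟧ ⟨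
          ι (⟦ a′ ⟧ ℕ.+ ⟦ a ⟧)                ≈⟨ *-identityˡ _ ⟨
          1# · ι (⟦ a′ ⟧ ℕ.+ ⟦ a ⟧)           ≈⟨ *-congʳ hN≈1 ⟨
          h · ι N · ι (⟦ a′ ⟧ ℕ.+ ⟦ a ⟧)      ≈⟨ *-assoc h (ι N) _ ⟩
          h · (ι N · ι (⟦ a′ ⟧ ℕ.+ ⟦ a ⟧))    ≈⟨ *-congˡ (×1-homo-* N _) ⟨
          h · ι (N ℕ.* (⟦ a′ ⟧ ℕ.+ ⟦ a ⟧))    ≈⟨ *-congˡ (reflexive (≡.cong ι (≡.trans eq (≡.cong (t ℕ.+_) (ℕ.+-identityʳ t))))) ⟩
          h · ι (t ℕ.+ t)                     ≈⟨ *-congˡ (ι-+ t t) ⟩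
          h · (ι t + ι t)                     ≈⟨ distribˡ h (ι t) (ι t) ⟩
          h · ι t + h · ι t                   ≈⟨ distribʳ (ι t) h h ⟨
          τ · ι t                             ∎

        adj-same : ∀ {a a′} → ⟦ a′ ⟧ ≡ ⟦ a ⟧ → (if a′ then 1# else 0#) ≈ (if a then 1# else 0#)
        adj-same {a} {a′} eq = trans (sym (ι-⟦⟧ a′)) (trans (reflexive (≡.cong ι eq)) (ι-⟦⟧ a))

        -- The left side is the entry of A′ Q and the right side that of Q A, written with `s` on
        -- both sides because switching preserves it. The Booleans stand for membership of `r` and
        -- `u` in `X`, abstracted so that each of the four blocks computes once they are known.
        Block : Bool → Bool → Fin n → Fin n → Set ℓ₁
        Block b c u r = τ · ι (s u) · (if c then 1# else 0#) + (if c then - 1# else 1#) · adjMatrix G′ u r ≈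
                        (if b then 1# else 0#) · (τ · ι (s r)) + (if b then - 1# else 1#) · adjMatrix G u r

        -- Entrywise, A′ Q ≈ Q A.
        intertwine-entry : ∀ u r → Block (lookup X u) (lookup X r) u r
        intertwine-entry u r with u ∈? X | r ∈? X
        -- On the block of `X` the two multiples of the all-ones matrix agree because `X` is
        -- regular.
        ... | yes u∈X | yes r∈X = ≡.subst₂ (λ b c → Block b c u r) (≡.sym ([]=⇒lookup u∈X)) (≡.sym ([]=⇒lookup r∈X)) (
          +-cong (trans (*-comm _ 1#) (*-congˡ (*-congˡ (reflexive (≡.cong ι (≡.trans (regular u u∈X) (≡.sym (regular r r∈X))))))))
                 (*-congˡ (adj-same {adj G u r} {adj G′ u r} (switch-inside G X u∈X r∈X))))
          where regular = proj₂ (IsSwitchingSet.regular S)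
        ... | no  u∉X | no  r∉X = ≡.subst₂ (λ b c → Block b c u r) (≡.sym (∉⇒lookup u∉X)) (≡.sym (∉⇒lookup r∉X)) (
          +-cong (trans (zeroʳ _) (sym (zeroˡ _))) (*-congˡ (adj-same {adj G u r} {adj G′ u r} (switch-outside G X u∉X r∉X))))
        ... | yes u∈X | no  r∉X = ≡.subst₂ (λ b c → Block b c u r) (≡.sym ([]=⇒lookup u∈X)) (≡.sym (∉⇒lookup r∉X)) (begin
          τ · ι (s u) · 0# + 1# · adjMatrix G′ u r
            ≈⟨ +-cong (zeroʳ _) (*-identityˡ _) ⟩
          0# + adjMatrix G′ u r
            ≈⟨ trans (+-identityˡ _) (sym (x+y-y _ (adjMatrix G u r))) ⟩
          (adjMatrix G′ u r + adjMatrix G u r) + - 1# · adjMatrix G u r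
            ≈⟨ +-congʳ (adj-cross {adj G u r} {adj G′ u r} (s r) (switch-cross G X u∈X r∉X (IsSwitchingSet.outside S r r∉X))) ⟩
          τ · ι (s r) + - 1# · adjMatrix G u r
            ≈⟨ +-congʳ (*-identityˡ _) ⟨
          1# · (τ · ι (s r)) + - 1# · adjMatrix G u r ∎)
        ... | no  u∉X | yes r∈X = ≡.subst₂ (λ b c → Block b c u r) (≡.sym (∉⇒lookup u∉X)) (≡.sym ([]=⇒lookup r∈X)) (begin
          τ · ι (s u) · 1# + - 1# · adjMatrix G′ u r
            ≈⟨ +-congʳ (trans (*-identityʳ _) (trans (sym (adj-cross {adj G u r} {adj G′ u r} (s u) (switch-cross′ G X S r∈X u∉X))) (+-comm _ _))) ⟩
          (adjMatrix G u r + adjMatrix G′ u r) + - 1# · adjMatrix G′ u r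
            ≈⟨ x+y-y _ _ ⟩
          adjMatrix G u r
            ≈⟨ trans (+-congˡ (*-identityˡ _)) (+-identityˡ _) ⟨
          0# + 1# · adjMatrix G u r
            ≈⟨ +-congʳ (zeroˡ _) ⟨
          0# · (τ · ι (s r)) + 1# · adjMatrix G u r ∎)

        ι-nbrsIn : (K : Graph n) → ∀ v → ι (nbrsIn K X v) ≈ sum (λ w → χ w · adjMatrix K w v)
        ι-nbrsIn K v = trans (reflexive (≡.cong ι (nbrsIn≡∑ K X v)))
          (trans (ι-sum (λ w → ⟦ lookup X w ⟧ ℕ.* entry K w v)) (sum-cong-≋ λ w →
            trans (×1-homo-* ⟦ lookup X w ⟧ _) (*-cong (ι-⟦⟧ (lookup X w)) (ι-⟦⟧ (adj K w v)))))

        adjMatrix-sym : (K : Graph n) → ∀ u v → adjMatrix K u v ≈ adjMatrix K v u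
        adjMatrix-sym K u v = reflexive (≡.cong (if_then 1# else 0#) (adj-sym K u v))

        -- A′ Q = Q A is used in place of A′ = Q A Q, since its entries are linear in `Q`. The other
        -- direction, A Q = Q A′, follows from it by involutivity.
        intertwine : ∀ x u → apply G′ (Q x) u ≈ Q (apply G x) u
        intertwine x u = begin
          sum (λ r → a′ r · (χ r · (τ · σ x) + ε r · x r))
            ≈⟨ sum-cong-≋ (λ r → trans (distribˡ (a′ r) _ _) (+-cong (trans (sym (*-assoc (a′ r) (χ r) _)) (*-congʳ (*-comm (a′ r) (χ r))))
                 (trans (sym (*-assoc (a′ r) (ε r) (x r))) (*-congʳ (*-comm (a′ r) (ε r)))))) ⟩
          sum (λ r → χ r · a′ r · (τ · σ x) + ε r · a′ r · x r)
            ≈⟨ ∑-distrib-+ {n} _ _ ⟩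
          sum (λ r → χ r · a′ r · (τ · σ x)) + sum (λ r → ε r · a′ r · x r)
            ≈⟨ +-congʳ (*-distribʳ-sum {n} (τ · σ x) (λ r → χ r · a′ r)) ⟨
          sum (λ r → χ r · a′ r) · (τ · σ x) + sum (λ r → ε r · a′ r · x r)
            ≈⟨ +-congʳ (*-congʳ row) ⟩
          ι (s u) · (τ · σ x) + sum (λ r → ε r · a′ r · x r)
            ≈⟨ +-congʳ (trans (sym (*-assoc (ι (s u)) τ (σ x))) (*-congʳ (*-comm (ι (s u)) τ))) ⟩
          τ · ι (s u) · σ x + sum (λ r → ε r · a′ r · x r)
            ≈⟨ +-congʳ (*-distribˡ-sum {n} _ _) ⟩
          sum (λ r → τ · ι (s u) · (χ r · x r)) + sum (λ r → ε r · a′ r · x r)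
            ≈⟨ ∑-distrib-+ {n} _ _ ⟨
          sum (λ r → τ · ι (s u) · (χ r · x r) + ε r · a′ r · x r)
            ≈⟨ sum-cong-≋ (λ r → trans (+-congʳ (sym (*-assoc _ (χ r) (x r)))) (sym (distribʳ (x r) _ _))) ⟩
          sum (λ r → (τ · ι (s u) · χ r + ε r · a′ r) · x r)
            ≈⟨ sum-cong-≋ (λ r → *-congʳ (intertwine-entry u r)) ⟩
          sum (λ r → (χ u · (τ · ι (s r)) + ε u · a r) · x r)
            ≈⟨ sum-cong-≋ (λ r → trans (distribʳ (x r) _ _) (+-cong (trans (*-assoc (χ u) _ (x r)) (*-congˡ (*-assoc τ _ (x r)))) (*-assoc (ε u) (a r) (x r)))) ⟩
          sum (λ r → χ u · (τ · (ι (s r) · x r)) + ε u · (a r · x r))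
            ≈⟨ ∑-distrib-+ {n} _ _ ⟩
          sum (λ r → χ u · (τ · (ι (s r) · x r))) + sum (λ r → ε u · (a r · x r))
            ≈⟨ +-cong (trans (*-congˡ (*-distribˡ-sum {n} τ _)) (*-distribˡ-sum {n} (χ u) _)) (*-distribˡ-sum {n} (ε u) _) ⟨
          χ u · (τ · sum (λ r → ι (s r) · x r)) + ε u · apply G x u
            ≈⟨ +-congʳ (*-congˡ (*-congˡ column)) ⟩
          Q (apply G x) u ∎
          where
          a a′ : Vector Carrier n
          a  = adjMatrix G u
          a′ = adjMatrix G′ u

          row : sum (λ r → χ r · a′ r) ≈ ι (s u)
          row = trans (sum-cong-≋ (λ r → *-congˡ {χ r} (adjMatrix-sym G′ u r)))
            (trans (sym (ι-nbrsIn G′ u)) (reflexive (≡.cong ι (nbrsIn-switch G X 0<N S u))))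

          column : sum (λ r → ι (s r) · x r) ≈ σ (apply G x)
          column = begin
            sum (λ r → ι (s r) · x r)
              ≈⟨ sum-cong-≋ (λ r → *-congʳ (ι-nbrsIn G r)) ⟩
            sum (λ r → sum (λ w → χ w · adjMatrix G w r) · x r)
              ≈⟨ sum-cong-≋ (λ r → *-distribʳ-sum {n} (x r) _) ⟩
            sum (λ r → sum (λ w → χ w · adjMatrix G w r · x r))
              ≈⟨ ∑-comm {n} {n} _ ⟩
            sum (λ w → sum (λ r → χ w · adjMatrix G w r · x r))
              ≈⟨ sum-cong-≋ (λ w → trans (sum-cong-≋ {n} (λ r → *-assoc (χ w) _ (x r))) (sym (*-distribˡ-sum {n} (χ w) _))) ⟩
            σ (apply G x) ∎

        apply-cong : (K : Graph n) → ∀ {x y} → (∀ u → x u ≈ y u) → ∀ u → apply K x u ≈ apply K y u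
        apply-cong K x≈y u = sum-cong-≋ (λ v → *-congˡ (x≈y v))

        module _ (θ : Carrier) where

          Q-eigen : ∀ x → InEigenspace G θ x → InEigenspace G′ θ (Q x)
          Q-eigen x x∈E u = trans (intertwine x u) (trans (Q-cong x∈E u) (Q-scale θ x u))

          Q-eigen⁻¹ : ∀ x → InEigenspace G′ θ x → InEigenspace G θ (Q x)
          Q-eigen⁻¹ x x∈E u = begin
            apply G (Q x) u             ≈⟨ Q-involutive (apply G (Q x)) u ⟨
            Q (Q (apply G (Q x))) u     ≈⟨ Q-cong (intertwine (Q x)) u ⟨
            Q (apply G′ (Q (Q x))) u    ≈⟨ Q-cong (apply-cong G′ (Q-involutive x)) u ⟩
            Q (apply G′ x) u            ≈⟨ Q-cong x∈E u ⟩
            Q (λ v → θ · x v) u         ≈⟨ Q-scale θ x u ⟩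
            θ · Q x u                   ∎

      switch-multiplicity : ∀ θ k → HasMultiplicity G θ k ⇔ HasMultiplicity G′ θ k
      switch-multiplicity θ k = mk⇔
        (transport G G′ Q Q-cong Q-combination Q-zero Q-involutive θ (Q-eigen θ) (Q-eigen⁻¹ θ))
        (transport G′ G Q Q-cong Q-combination Q-zero Q-involutive θ (Q-eigen⁻¹ θ) (Q-eigen θ))

    invertible : CharZero → ∀ k → 0 < k → ∃[ h ] h · ι k ≈ 1#
    invertible char0 (suc k) _ with #⇒invertible (char0 k)
    -- Apartness from zero yields an inverse of the difference k - 0, from which the zero has to be
    -- removed.
    ... | h , hk≈1 , _ = h , trans (*-congˡ (sym (trans (+-congˡ -0#≈0#) (+-identityʳ _)))) hk≈1

  switch-cospectral : ∀ c ℓ₁ ℓ₂ (G : Graph n) (X : Subset n) → 0 < ∣ X ∣ → IsSwitchingSet G X →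
                      Cospectral c ℓ₁ ℓ₂ G (switch G X)
  switch-cospectral c ℓ₁ ℓ₂ G X 0<N S F char0 =
    let h , hN≈1 = invertible F char0 ∣ X ∣ 0<N in switch-multiplicity F G X h hN≈1 0<N S

-- The tensor and the strengthened tensor product as instances

open CommonNeighbours
open Spectra
open import Relation.Binary.PropositionalEquality using (refl; sym; trans; cong; subst; ≢-sym)

theorem4p1 : ∀ (c ℓ₁ ℓ₂ : Level) {n : ℕ} (G : Graph n) (X : Subset n) →
    Nonempty X →
    IsSwitchingSet G X →
    (∀ u v → u ∈ X → v ∈ X → degree G u ≡ degree G v) →
    Λ̄ G X ↭ Λ̄ (switch G X) X →
    ( (∀ u v → u ∈ X → v ∈ X → adj G u v ≡ false)
    × 2 ≤ ∣ halfSet G X ∣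
    × NoComplementaryRows G X (halfSet G X) )
    ⊎
    ( (∀ u → u ∈ X → 2 * nbrsIn G X u ≡ ∣ X ∣)
    × NoComplementaryRows G X (X ∪ halfSet G X) ) →
    ∀ {m : ℕ} (H : Graph m) (i : Fin m) →
    IsSwitchingSet (H ×ᵍ G) (⁅ i ⁆ ×ˢ X)
    × IsSwitchingSet (H ⊠ G) (⁅ i ⁆ ×ˢ X)
    × ( 1 ≤ degree H i →
    Cospectral c ℓ₁ ℓ₂ (H ⊠ G) (switch (H ⊠ G) (⁅ i ⁆ ×ˢ X))
    × ¬ (H ⊠ G ≅ switch (H ⊠ G) (⁅ i ⁆ ×ˢ X)) )
    × ( (∃[ j ] (adj H i j ≡ true × 2 ≤ degree H j)) →
    Cospectral c ℓ₁ ℓ₂ (H ×ᵍ G) (switch (H ×ᵍ G) (⁅ i ⁆ ×ˢ X))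
    × ¬ (H ×ᵍ G ≅ switch (H ×ᵍ G) (⁅ i ⁆ ×ˢ X)) )
theorem4p1 c ℓ₁ ℓ₂ {n} G X X≠∅ S equidegree Λ̄-↭ cases {m} H i =
  T.isSwitchingSet , ST.isSwitchingSet , strengthened , tensor
  where
  admissible : Admissible G X
  admissible = Sum.[ (λ (coclique , 2≤∣half∣ , noncomp) → coclique-admissible G X S coclique 2≤∣half∣ noncomp)
                   , (λ (half-regular , noncomp) → half-regular-admissible G X X≠∅ S half-regular noncomp) ] cases
  open Admissible admissible

  module T = Product G X S split (H ×ᵍ G) (adj H) (adj-×ᵍ H G) i
  module ST = Product G X S split (H ⊠ G) (adjOrEq H) (adj-⊠ H G) i

  degree-const : ∀ u → u ∈ X → degree G u ≡ degree G (proj₁ X≠∅)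
  degree-const u u∈X = equidegree u (proj₁ X≠∅) u∈X (proj₂ X≠∅)

  0<∣Z∣ : 0 < ∣ ⁅ i ⁆ ×ˢ X ∣
  0<∣Z∣ = subst (0 <_) (sym T.∣Z∣≡∣X∣) (∈⇒0<∣∣ G X (proj₂ X≠∅))

  adjOrEq-refl : adjOrEq H i i ≡ true
  adjOrEq-refl with i Fin.≟ i
  ... | yes _  = refl
  ... | no i≢i = contradiction refl i≢i

  strengthened : 1 ≤ degree H i →
    Cospectral c ℓ₁ ℓ₂ (H ⊠ G) (switch (H ⊠ G) (⁅ i ⁆ ×ˢ X)) × ¬ (H ⊠ G ≅ switch (H ⊠ G) (⁅ i ⁆ ×ˢ X))
  strengthened 1≤deg =
    let k , ik = neighbour H 1≤deg in
    switch-cospectral c ℓ₁ ℓ₂ (H ⊠ G) (⁅ i ⁆ ×ˢ X) 0<∣Z∣ ST.isSwitchingSet ,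
    ST.switch-≇ X≠∅ (degree G (proj₁ X≠∅)) degree-const Λ̄-↭ P nonempty half noncomplementary
      (≢-sym (adj⇒≢ H ik))
      -- The walk i, i, k: the loop from I, then an edge to any neighbour of `i`.
      (ST.walks-positive adjOrEq-refl (trans (cong (⌊ i Fin.≟ k ⌋ ∨_) ik) (∨-zeroʳ _)))

  tensor : (∃[ j ] (adj H i j ≡ true × 2 ≤ degree H j)) →
    Cospectral c ℓ₁ ℓ₂ (H ×ᵍ G) (switch (H ×ᵍ G) (⁅ i ⁆ ×ˢ X)) × ¬ (H ×ᵍ G ≅ switch (H ×ᵍ G) (⁅ i ⁆ ×ˢ X))
  tensor (j , ij , 2≤deg) =
    let k , k≢i , jk = other-neighbour H i 2≤deg in
    switch-cospectral c ℓ₁ ℓ₂ (H ×ᵍ G) (⁅ i ⁆ ×ˢ X) 0<∣Z∣ T.isSwitchingSet ,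
    T.switch-≇ X≠∅ (degree G (proj₁ X≠∅)) degree-const Λ̄-↭ P nonempty half noncomplementary
      -- Without loops the walk is i, j, k, and the second neighbour of `j` is what lets it end away
      -- from `i`.
      k≢i (T.walks-positive ij jk)
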